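{- Let $\mathrm{M}$ be a matroid on a finite ground set and let $K<L$ be flats of $\mathrm{M}$. Then $\mathrm{vol}_K^L=\mathrm{pol}_K^L$ as polynomials in the variables $t_F$, $F$ a flat with $K<F<L$, where $\mathrm{vol}_K^L$ is the volume polynomial of the Chow ring $A_K^L$ and $\mathrm{pol}_K^L$ is the recursively defined polynomial attached to the interval $[K,L]$ of the lattice of flats $\mathscr{P}$ of $\mathrm{M}$.
   Context: Throughout $\subset$ denotes strict inclusion, $\mathscr{P}$ is the lattice of flats of $\mathrm{M}$ ordered by inclusion, $<$ and $\prec$ are the order and cover relations of $\mathscr{P}$; $r(K,L)$ is the rank (length of a maximal chain) of $[K,L]$ in $\mathscr{P}$ and $d(K,L)=r(K,L)-1$. The polynomials $\mathrm{pol}_K^L$: for finite sets $K\subset L$ let $\mathscr{E}_K^L=\{(y_S)_{K\subset S\subset L}:y_S\in\mathbb{R}\}$, indexed by all sets $S$ strictly between $K$ and $L$. For $K\subseteq F\subset G\subseteq L$ define the linear map $\pi_F^G:\mathscr{E}_K^L\to\mathscr{E}_F^G$ by $$\pi_F^G(\mathbf{t})=\Big(t_S-t_G\frac{|S\setminus F|}{|G\setminus F|}-t_F\frac{|G\setminus S|}{|G\setminus F|}\Big)_{F\subset S\subset G},\qquad t_K=t_L=0.$$ For flats $K<L$ the polynomial $\mathrm{pol}_K^L(\mathbf{t})$ in the variables $\{t_F:F\in\mathscr{P},K<F<L\}$ is defined recursively by $\mathrm{pol}_K^L=1$ if $d(K,L)=0$, and if $d(K,L)\ge1$, $$d(K,L)\cdot\mathrm{pol}_K^L(\mathbf{t})=\sum_{F\in\mathscr{P},\,K<F<L}t_F\cdot\mathrm{pol}_K^F(\pi_K^F(\mathbf{t}))\cdot\mathrm{pol}_F^L(\pi_F^L(\mathbf{t})).$$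 Chow ring: $A_K^L=\mathbb{R}[x_F:F\in\mathscr{P},K<F<L]/(I+J)$, where $I$ is the ideal generated by all monomials $x_Fx_G$ with $F,G$ non-comparable flats strictly between $K$ and $L$, and $J$ is the ideal generated by the linear forms $\sum_{F\ni i}x_F-\sum_{F\ni j}x_F$ for distinct $i,j\in L\setminus K$ (sums over flats $F$ with $K<F<L$). It is graded, $A_K^L=\bigoplus_{k=0}^d(A_K^L)_k$ with $d=d(K,L)$, and it is a known fact (Adiprasito–Huh–Katz) that there is a well-defined linear isomorphism $\deg:(A_K^L)_d\to\mathbb{R}$ with $\deg(x_{F_1}x_{F_2}\cdots x_{F_d})=1$ for every maximal flag of flats $K\prec F_1\prec\cdots\prec F_d\prec L$. Volume polynomial: $\mathrm{vol}_K^L(\mathbf{t})=\frac{1}{d!}\deg\Big(\big(\sum_{K<F<L}x_Ft_F\big)^d\Big)$, $d=d(K,L)$, where $\deg$ is extended linearly to coefficients in $\mathbb{R}[\mathbf{t}]$. -}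

module Defs where

open import Algebra.Bundles using (CommutativeRing)
open import Algebra.Structures using (IsCommutativeRing)
open import Algebra.Module.Bundles.Raw using (RawLeftModule; module RawLeftModule)
import Algebra.Module.Construct.TensorUnit as TensorUnit
open import Algebra.Module.Morphism.Structures using (module LeftModuleMorphisms)
import Algebra.Properties.AbelianGroup as AbelianGroupProperties
import Algebra.Properties.CommutativeSemigroup as CommutativeSemigroupProperties
import Algebra.Properties.Ring as RingProperties
open import Data.Bool.Base using (true; false; if_then_else_)
open import Data.Fin.Base using (Fin)
import Data.Fin.Properties as Fin
open import Data.Fin.Subset using (Subset; inside; outside; _∈_; _∉_; _⊆_; _⊈_; _⊂_; _∪_; _∩_; _─_; ⁅_⁆; ∣_∣)
open import Data.Fin.Subset.Properties using (_∈?_; _⊂?_; ∣p∣≤n; p⊂q⇒∣p∣<∣q∣)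
import Data.Integer.Base as ℤ
open import Data.List.Base as List using (List; []; _∷_; _++_)
open import Data.List.Extrema.Nat using (max)
import Data.List.Properties as List
open import Data.List.Relation.Unary.Linked using (Linked)
open import Data.Maybe.Base as Maybe using (Maybe; maybe′)
open import Data.Nat.Base as ℕ using (ℕ; zero; suc; _∸_; _!)
import Data.Nat.Properties as ℕ
open import Data.Product.Base using (∃-syntax; _×_; _,_; proj₁)
open import Data.Rational.Base as ℚ using (ℚ; 0ℚ; 1ℚ; ½)
import Data.Rational.Properties as ℚ
open import Data.Vec.Base as Vec using (Vec; []; _∷_)
open import Function.Base using (_on_)
open import Level using (0ℓ)
open import Relation.Binary.Core using (Rel)
import Relation.Binary.Definitions as Binary
open import Relation.Binary.PropositionalEquality as ≡ using (_≡_; _≢_)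
open import Relation.Nullary using (¬_; does; contradiction)
open import Relation.Nullary.Decidable using (yes; no; ¬?; _→-dec_; _×-dec_; dec⇒maybe; recompute)
open import Relation.Unary using (Pred; Decidable)

private
  module Difference {c ℓ} (R : CommutativeRing c ℓ) where
    open CommutativeRing R
    open AbelianGroupProperties +-abelianGroup
    open CommutativeSemigroupProperties +-commutativeSemigroup using (interchange)
    open RingProperties ring using (x[y-z]≈xy-xz; [y-z]x≈yx-zx)

    diff-trans : ∀ a b c → a - c ≈ (a - b) + (b - c)
    diff-trans a b c = trans (+-congʳ (sym (//-rightDividesˡ b a))) (+-assoc (a - b) b (- c))

    diff-+ : ∀ a b c d → (a + b) - (c + d) ≈ (a - c) + (b - d)
    diff-+ a b c d = trans (+-congˡ (sym (⁻¹-∙-comm c d))) (interchange a b (- c) (- d))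

    diff-neg : ∀ a b → - a - - b ≈ - (a - b)
    diff-neg a b = ⁻¹-∙-comm a (- b)

    diff-flip : ∀ a b → a - b ≈ - (b - a)
    diff-flip a b = sym (⁻¹-anti-homo‿- b a)

    diff-back : ∀ a b → a ≈ (a - b) + b
    diff-back a b = sym (//-rightDividesˡ b a)

    diff-* : ∀ a b c d → a * b - c * d ≈ a * (b - d) + d * (a - c)
    diff-* a b c d = trans (diff-trans (a * b) (a * d) (c * d))
      (+-cong (sym (x[y-z]≈xy-xz a b d)) (trans (sym ([y-z]x≈yx-zx d a c)) (*-comm (a - c) d)))

-- Two sequences of rationals are close when x m - y n tends to 0 as m and n
-- tend to infinity. A sequence close to itself is a Cauchy sequence, and two
-- Cauchy sequences are close when they have the same limit.
record Close (x y : ℕ → ℚ) : Set where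
  constructor mkClose
  field
    eventually : ∀ ε → 0ℚ ℚ.< ε →
      ∃[ N ] (∀ {m n} → N ℕ.≤ m → N ℕ.≤ n → ℚ.∣ x m ℚ.- y n ∣ ℚ.< ε)

record ℝ : Set where
  no-eta-equality; pattern
  constructor real
  field
    seq    : ℕ → ℚ
    cauchy : Close seq seq

record _≈ℝ_ (x y : ℝ) : Set where
  constructor mk≈ℝ
  field close : Close (ℝ.seq x) (ℝ.seq y)

infix  4 _≈ℝ_
infixl 6 _+ℝ_
infixl 7 _*ℝ_
infix  8 -ℝ_

open Close

private

  2∣ : ∀ {ε} → 0ℚ ℚ.< ε → 0ℚ ℚ.< ½ ℚ.* ε
  2∣ 0<ε = ℚ.*-monoʳ-<-pos ½ 0<ε

  ½+½ : ∀ ε → ½ ℚ.* ε ℚ.+ ½ ℚ.* ε ≡ ε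
  ½+½ ε = ≡.trans (≡.sym (ℚ.*-distribʳ-+ ε ½ ½)) (ℚ.*-identityˡ ε)

  split< : ∀ {p q r ε} → r ≡ p ℚ.+ q → ℚ.∣ p ∣ ℚ.< ½ ℚ.* ε → ℚ.∣ q ∣ ℚ.< ½ ℚ.* ε → ℚ.∣ r ∣ ℚ.< ε
  split< {p} {q} {_} {ε} ≡.refl p< q< =
    ℚ.≤-<-trans (ℚ.∣p+q∣≤∣p∣+∣q∣ p q) (≡.subst (_ ℚ.<_) (½+½ ε) (ℚ.+-mono-< p< q<))

  open Difference ℚ.+-*-commutativeRing

  ⊔-l : ∀ {N M n} → N ℕ.⊔ M ℕ.≤ n → N ℕ.≤ n
  ⊔-l {N} {M} = ℕ.≤-trans (ℕ.m≤m⊔n N M)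

  ⊔-r : ∀ {N M n} → N ℕ.⊔ M ℕ.≤ n → M ℕ.≤ n
  ⊔-r {N} {M} = ℕ.≤-trans (ℕ.m≤n⊔m N M)

  close-sym : ∀ {x y} → Close x y → Close y x
  close-sym {x} {y} c .eventually ε 0<ε with c .eventually ε 0<ε
  ... | N , h = N , λ {m} {n} p q →
    ≡.subst (ℚ._< ε) (≡.trans (≡.sym (ℚ.∣-p∣≡∣p∣ (x n ℚ.- y m))) (≡.cong ℚ.∣_∣ (≡.sym (diff-flip (y m) (x n))))) (h q p)

  close-trans : ∀ {x y z} → Close x y → Close y z → Close x z
  close-trans {x} {y} {z} c d .eventually ε 0<ε with c .eventually (½ ℚ.* ε) (2∣ 0<ε) | d .eventually (½ ℚ.* ε) (2∣ 0<ε)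
  ... | N , h | M , k = N ℕ.⊔ M , λ {m} {n} p q →
    split< (diff-trans (x m) (y (N ℕ.⊔ M)) (z n)) (h (⊔-l p) (ℕ.m≤m⊔n N M)) (k (ℕ.m≤n⊔m N M) (⊔-r {N} q))

  close-+ : ∀ {x x′ y y′} → Close x x′ → Close y y′ → Close (λ n → x n ℚ.+ y n) (λ n → x′ n ℚ.+ y′ n)
  close-+ {x} {x′} {y} {y′} c d .eventually ε 0<ε with c .eventually (½ ℚ.* ε) (2∣ 0<ε) | d .eventually (½ ℚ.* ε) (2∣ 0<ε)
  ... | N , h | M , k = N ℕ.⊔ M , λ {m} {n} p q →
    split< (diff-+ (x m) (y m) (x′ n) (y′ n)) (h (⊔-l p) (⊔-l q)) (k (⊔-r {N} p) (⊔-r {N} q))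

  close-neg : ∀ {x y} → Close x y → Close (λ n → ℚ.- x n) (λ n → ℚ.- y n)
  close-neg {x} {y} c .eventually ε 0<ε with c .eventually ε 0<ε
  ... | N , h = N , λ {m} {n} p q →
    ≡.subst (ℚ._< ε) (≡.sym (≡.trans (≡.cong ℚ.∣_∣ (diff-neg (x m) (y n))) (ℚ.∣-p∣≡∣p∣ (x m ℚ.- y n)))) (h p q)

  Bound : (ℕ → ℚ) → ℚ → ℕ → Set
  Bound x B N = ∀ {n} → N ℕ.≤ n → ℚ.∣ x n ∣ ℚ.≤ B

  bounded : ∀ {x} → Close x x → ∃[ B ] ∃[ N ] (ℚ.Positive B × Bound x B N)
  bounded {x} c with c .eventually 1ℚ (ℚ.positive⁻¹ 1ℚ)
  ... | N , h = 1ℚ ℚ.+ ℚ.∣ x N ∣ , N ,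
      ℚ.positive (ℚ.+-mono-<-≤ (ℚ.positive⁻¹ 1ℚ) (ℚ.0≤∣p∣ (x N))) , λ {n} p → begin
        ℚ.∣ x n ∣                            ≡⟨ ≡.cong ℚ.∣_∣ (diff-back (x n) (x N)) ⟩
        ℚ.∣ (x n ℚ.- x N) ℚ.+ x N ∣          ≤⟨ ℚ.∣p+q∣≤∣p∣+∣q∣ (x n ℚ.- x N) (x N) ⟩
        ℚ.∣ x n ℚ.- x N ∣ ℚ.+ ℚ.∣ x N ∣      ≤⟨ ℚ.+-monoˡ-≤ ℚ.∣ x N ∣ (ℚ.<⇒≤ (h p ℕ.≤-refl)) ⟩
        1ℚ ℚ.+ ℚ.∣ x N ∣                     ∎
    where open ℚ.≤-Reasoning

  -- the threshold δ with B * δ ≡ ε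
  quot : ∀ B → ℚ.Positive B → ℚ → ℚ
  quot B pos ε = ((ℚ.1/ B) {{ℚ.pos⇒nonZero B {{pos}}}}) ℚ.* ε

  quot-pos : ∀ B pos {ε} → 0ℚ ℚ.< ε → 0ℚ ℚ.< quot B pos ε
  quot-pos B pos 0<ε = ≡.subst (ℚ._< quot B pos _) (ℚ.*-zeroʳ (1/B))
      (ℚ.*-monoʳ-<-pos 1/B {{ℚ.1/pos⇒pos B {{pos}}}} 0<ε)
    where 1/B = (ℚ.1/ B) {{ℚ.pos⇒nonZero B {{pos}}}}

  scaled< : ∀ B pos p q {ε} → ℚ.∣ p ∣ ℚ.≤ B → ℚ.∣ q ∣ ℚ.< quot B pos ε → ℚ.∣ p ℚ.* q ∣ ℚ.< ε
  scaled< B pos p q {ε} p≤ q< = begin-strict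
      ℚ.∣ p ℚ.* q ∣          ≡⟨ ℚ.∣p*q∣≡∣p∣*∣q∣ p q ⟩
      ℚ.∣ p ∣ ℚ.* ℚ.∣ q ∣    ≤⟨ ℚ.*-monoʳ-≤-nonNeg ℚ.∣ q ∣ {{ℚ.nonNegative (ℚ.0≤∣p∣ q)}} p≤ ⟩
      B ℚ.* ℚ.∣ q ∣          <⟨ ℚ.*-monoʳ-<-pos B {{pos}} q< ⟩
      B ℚ.* (1/B ℚ.* ε)      ≡⟨ ≡.sym (ℚ.*-assoc B 1/B ε) ⟩
      (B ℚ.* 1/B) ℚ.* ε      ≡⟨ ≡.cong (ℚ._* ε) (ℚ.*-inverseʳ B {{ℚ.pos⇒nonZero B {{pos}}}}) ⟩
      1ℚ ℚ.* ε               ≡⟨ ℚ.*-identityˡ ε ⟩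
      ε                      ∎
    where
    open ℚ.≤-Reasoning
    1/B = (ℚ.1/ B) {{ℚ.pos⇒nonZero B {{pos}}}}

  close-* : ∀ {x x′ y y′} → Close x x → Close y′ y′ → Close x x′ → Close y y′ →
            Close (λ n → x n ℚ.* y n) (λ n → x′ n ℚ.* y′ n)
  close-* {x} {x′} {y} {y′} cx cy′ c d .eventually ε 0<ε with bounded cx | bounded cy′
  ... | B , N₁ , posB , x≤ | D , N₂ , posD , y′≤
    with c .eventually (quot D posD (½ ℚ.* ε)) (quot-pos D posD (2∣ 0<ε)) | d .eventually (quot B posB (½ ℚ.* ε)) (quot-pos B posB (2∣ 0<ε))
  ... | N₃ , h | N₄ , k = (N₁ ℕ.⊔ N₂) ℕ.⊔ (N₃ ℕ.⊔ N₄) , λ {m} {n} p q →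
    split< {x m ℚ.* (y m ℚ.- y′ n)} {y′ n ℚ.* (x m ℚ.- x′ n)} (diff-* (x m) (y m) (x′ n) (y′ n))
      (scaled< B posB (x m) (y m ℚ.- y′ n) (x≤ (⊔-l {N₁} {N₂} (⊔-l p)))
        (k (⊔-r {N₃} (⊔-r {N₁ ℕ.⊔ N₂} p)) (⊔-r {N₃} (⊔-r {N₁ ℕ.⊔ N₂} q))))
      (scaled< D posD (y′ n) (x m ℚ.- x′ n) (y′≤ (⊔-r {N₁} (⊔-l q)))
        (h (⊔-l {N₃} {N₄} (⊔-r {N₁ ℕ.⊔ N₂} p)) (⊔-l {N₃} {N₄} (⊔-r {N₁ ℕ.⊔ N₂} q))))

  close-const : ∀ q → Close (λ _ → q) (λ _ → q)
  close-const q .eventually ε 0<ε = 0 , λ _ _ → ≡.subst (λ r → ℚ.∣ r ∣ ℚ.< ε) (≡.sym (ℚ.+-inverseʳ q)) 0<ε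

  pointwise : (x y : ℝ) → (∀ n → ℝ.seq x n ≡ ℝ.seq y n) → x ≈ℝ y
  pointwise x y eq = mk≈ℝ (mkClose λ ε 0<ε → let N , h = ℝ.cauchy x .eventually ε 0<ε in N , λ {m} {n} p q →
    ≡.subst (λ r → ℚ.∣ ℝ.seq x m ℚ.- r ∣ ℚ.< ε) (eq n) (h p q))

-- The operations are opaque to keep them from unfolding to rational arithmetic
-- during type checking.
opaque

  fromℚ : ℚ → ℝ
  fromℚ q = real (λ _ → q) (close-const q)

  _+ℝ_ : ℝ → ℝ → ℝ
  real x cx +ℝ real y cy = real (λ n → x n ℚ.+ y n) (close-+ cx cy)

  _*ℝ_ : ℝ → ℝ → ℝ
  real x cx *ℝ real y cy = real (λ n → x n ℚ.* y n) (close-* cx cy cx cy)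

  -ℝ_ : ℝ → ℝ
  -ℝ real x cx = real (λ n → ℚ.- x n) (close-neg cx)

  ℝ-isCommutativeRing : IsCommutativeRing _≈ℝ_ _+ℝ_ _*ℝ_ -ℝ_ (fromℚ 0ℚ) (fromℚ 1ℚ)
  ℝ-isCommutativeRing = record
    { isRing = record
      { +-isAbelianGroup = record
        { isGroup = record
          { isMonoid = record
            { isSemigroup = record
              { isMagma = record
                { isEquivalence = record
                  { refl  = λ {x} → mk≈ℝ (ℝ.cauchy x)
                  ; sym   = λ {x} {y} x≈y → mk≈ℝ (close-sym {ℝ.seq x} {ℝ.seq y} (close x≈y))
                  ; trans = λ {x} {y} {z} x≈y y≈z → mk≈ℝ
                      (close-trans {ℝ.seq x} {ℝ.seq y} {ℝ.seq z} (close x≈y) (close y≈z))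
                  }
                ; ∙-cong = λ { {real _ _} {real _ _} {real _ _} {real _ _} x≈y u≈v →
                    mk≈ℝ (close-+ (close x≈y) (close u≈v)) }
                }
              ; assoc = λ { x@(real a _) y@(real b _) z@(real c _) →
                  pointwise ((x +ℝ y) +ℝ z) (x +ℝ (y +ℝ z)) (λ n → ℚ.+-assoc (a n) (b n) (c n)) }
              }
            ; identity = (λ { x@(real a _) → pointwise (fromℚ 0ℚ +ℝ x) x (λ n → ℚ.+-identityˡ (a n)) })
                       , (λ { x@(real a _) → pointwise (x +ℝ fromℚ 0ℚ) x (λ n → ℚ.+-identityʳ (a n)) })
            }
          ; inverse = (λ { x@(real a _) → pointwise ((-ℝ x) +ℝ x) (fromℚ 0ℚ) (λ n → ℚ.+-inverseˡ (a n)) })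
                    , (λ { x@(real a _) → pointwise (x +ℝ (-ℝ x)) (fromℚ 0ℚ) (λ n → ℚ.+-inverseʳ (a n)) })
          ; ⁻¹-cong = λ { {real _ _} {real _ _} x≈y → mk≈ℝ (close-neg (close x≈y)) }
          }
        ; comm = λ { x@(real a _) y@(real b _) → pointwise (x +ℝ y) (y +ℝ x) (λ n → ℚ.+-comm (a n) (b n)) }
        }
      ; *-cong = λ { {real _ cx} {real _ _} {real _ _} {real _ cv} x≈y u≈v →
          mk≈ℝ (close-* cx cv (close x≈y) (close u≈v)) }
      ; *-assoc = λ { x@(real a _) y@(real b _) z@(real c _) →
          pointwise ((x *ℝ y) *ℝ z) (x *ℝ (y *ℝ z)) (λ n → ℚ.*-assoc (a n) (b n) (c n)) }
      ; *-identity = (λ { x@(real a _) → pointwise (fromℚ 1ℚ *ℝ x) x (λ n → ℚ.*-identityˡ (a n)) })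
                   , (λ { x@(real a _) → pointwise (x *ℝ fromℚ 1ℚ) x (λ n → ℚ.*-identityʳ (a n)) })
      ; distrib = (λ { x@(real a _) y@(real b _) z@(real c _) →
                      pointwise (x *ℝ (y +ℝ z)) ((x *ℝ y) +ℝ (x *ℝ z)) (λ n → ℚ.*-distribˡ-+ (a n) (b n) (c n)) })
                , (λ { x@(real a _) y@(real b _) z@(real c _) →
                      pointwise ((y +ℝ z) *ℝ x) ((y *ℝ x) +ℝ (z *ℝ x)) (λ n → ℚ.*-distribʳ-+ (a n) (b n) (c n)) })
      }
    ; *-comm = λ { x@(real a _) y@(real b _) → pointwise (x *ℝ y) (y *ℝ x) (λ n → ℚ.*-comm (a n) (b n)) }
    }
    where open _≈ℝ_

  fromℚ-+ : ∀ p q → fromℚ (p ℚ.+ q) ≈ℝ fromℚ p +ℝ fromℚ q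
  fromℚ-+ p q = mk≈ℝ (close-const (p ℚ.+ q))

  fromℚ-* : ∀ p q → fromℚ (p ℚ.* q) ≈ℝ fromℚ p *ℝ fromℚ q
  fromℚ-* p q = mk≈ℝ (close-const (p ℚ.* q))

0ℝ 1ℝ : ℝ
0ℝ = fromℚ 0ℚ
1ℝ = fromℚ 1ℚ

ℝ-commutativeRing : CommutativeRing 0ℓ 0ℓ
ℝ-commutativeRing = record { isCommutativeRing = ℝ-isCommutativeRing }

-- The quotient a/b, with the convention a/0 = 0.
infixl 7 _÷_

_÷_ : ℕ → ℕ → ℝ
a ÷ zero  = 0ℝ
a ÷ suc b = fromℚ (ℤ.+ a ℚ./ suc b)

module Ideals (R : CommutativeRing 0ℓ 0ℓ) where
  open CommutativeRing R

  record Ideal : Set₁ where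
    field
      _∈I     : Pred Carrier 0ℓ
      resp-∈I : ∀ {x y} → x ≈ y → x ∈I → y ∈I
      0∈I     : 0# ∈I
      +-∈I    : ∀ {x y} → x ∈I → y ∈I → (x + y) ∈I
      *-∈I    : ∀ r {x} → x ∈I → (r * x) ∈I

  data Generated (G : Pred Carrier 0ℓ) : Pred Carrier 0ℓ where
    gen  : ∀ {x} → G x → Generated G x
    resp : ∀ {x y} → x ≈ y → Generated G x → Generated G y
    0∈   : Generated G 0#
    +-∈  : ∀ {x y} → Generated G x → Generated G y → Generated G (x + y)
    *-∈  : ∀ r {x} → Generated G x → Generated G (r * x)

  ⟨_⟩ : Pred Carrier 0ℓ → Ideal
  ⟨ G ⟩ = record { _∈I = Generated G ; resp-∈I = resp ; 0∈I = 0∈ ; +-∈I = +-∈ ; *-∈I = *-∈ }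

  infixl 6 _+ᴵ_

  _+ᴵ_ : Ideal → Ideal → Ideal
  I +ᴵ J = record
    { _∈I     = λ x → ∃[ a ] ∃[ b ] ((a ∈₁) × (b ∈₂) × x ≈ a + b)
    ; resp-∈I = λ { x≈y (a , b , a∈ , b∈ , eq) → a , b , a∈ , b∈ , trans (sym x≈y) eq }
    ; 0∈I     = 0# , 0# , I.0∈I , J.0∈I , sym (+-identityˡ 0#)
    ; +-∈I    = λ { (a , b , a∈ , b∈ , eq) (a′ , b′ , a′∈ , b′∈ , eq′) →
        a + a′ , b + b′ , I.+-∈I a∈ a′∈ , J.+-∈I b∈ b′∈ , trans (+-cong eq eq′) (interchange a b a′ b′) }
    ; *-∈I    = λ { r (a , b , a∈ , b∈ , eq) →
        r * a , r * b , I.*-∈I r a∈ , J.*-∈I r b∈ , trans (*-congˡ eq) (distribˡ r a b) }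
    }
    where
    module I = Ideal I renaming (_∈I to _∈₁)
    module J = Ideal J renaming (_∈I to _∈₂)
    open I using (_∈₁)
    open J using (_∈₂)
    open CommutativeSemigroupProperties +-commutativeSemigroup using (interchange)

  quotient : Ideal → CommutativeRing 0ℓ 0ℓ
  quotient I = record
    { Carrier = Carrier
    ; _≈_ = λ x y → (x - y) ∈I
    ; _+_ = _+_ ; _*_ = _*_ ; -_ = -_ ; 0# = 0# ; 1# = 1#
    ; isCommutativeRing = record
      { isRing = record
        { +-isAbelianGroup = record
          { isGroup = record
            { isMonoid = record
              { isSemigroup = record
                { isMagma = record
                  { isEquivalence = record
                    { refl  = λ {x} → lift {x} {x} refl
                    ; sym   = λ {x} {y} p → resp-∈I (sym (Δ.diff-flip y x)) (neg-∈ p)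
                    ; trans = λ {x} {y} {z} p q → resp-∈I (sym (Δ.diff-trans x y z)) (+-∈I p q)
                    }
                  ; ∙-cong = λ {x} {y} {u} {v} p q → resp-∈I (sym (Δ.diff-+ x u y v)) (+-∈I p q)
                  }
                ; assoc = λ x y z → lift (+-assoc x y z)
                }
              ; identity = (λ x → lift (+-identityˡ x)) , (λ x → lift (+-identityʳ x))
              }
            ; inverse = (λ x → lift (-‿inverseˡ x)) , (λ x → lift (-‿inverseʳ x))
            ; ⁻¹-cong = λ {x} {y} p → resp-∈I (sym (Δ.diff-neg x y)) (neg-∈ p)
            }
          ; comm = λ x y → lift (+-comm x y)
          }
        ; *-cong = λ {x} {y} {u} {v} p q → resp-∈I (sym (Δ.diff-* x u y v)) (+-∈I (*-∈I x q) (*-∈I v p))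
        ; *-assoc = λ x y z → lift (*-assoc x y z)
        ; *-identity = (λ x → lift (*-identityˡ x)) , (λ x → lift (*-identityʳ x))
        ; distrib = (λ x y z → lift (distribˡ x y z)) , (λ x y z → lift (distribʳ x y z))
        }
      ; *-comm = λ x y → lift (*-comm x y)
      }
    }
    where
    open Ideal I
    module Δ = Difference R
    open RingProperties ring using (-1*x≈-x)

    lift : ∀ {x y} → x ≈ y → (x - y) ∈I
    lift {x} {y} x≈y = resp-∈I (sym (trans (+-congʳ x≈y) (-‿inverseʳ y))) 0∈I

    neg-∈ : ∀ {x} → x ∈I → (- x) ∈I
    neg-∈ {x} x∈ = resp-∈I (-1*x≈-x x) (*-∈I (- 1#) x∈)

-- The polynomial ring ℝ[ V ] is the free commutative ℝ-algebra on V: its elements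
-- are the expressions built from constants and variables by the ring operations,
-- and _≈ₚ_ is the least congruence satisfying the commutative ring laws for which
-- con is a ring homomorphism.
infixl 6 _⊕_
infixl 7 _⊗_
infix  8 ⊖_
infix  4 _≈ₚ_

data ℝ[_] (V : Set) : Set where
  con : ℝ → ℝ[ V ]
  var : V → ℝ[ V ]
  _⊕_ : ℝ[ V ] → ℝ[ V ] → ℝ[ V ]
  _⊗_ : ℝ[ V ] → ℝ[ V ] → ℝ[ V ]
  ⊖_  : ℝ[ V ] → ℝ[ V ]

data _≈ₚ_ {V : Set} : ℝ[ V ] → ℝ[ V ] → Set where
  ≈-refl      : ∀ {p} → p ≈ₚ p
  ≈-sym       : ∀ {p q} → p ≈ₚ q → q ≈ₚ p
  ≈-trans     : ∀ {p q r} → p ≈ₚ q → q ≈ₚ r → p ≈ₚ r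
  ⊕-cong      : ∀ {p p′ q q′} → p ≈ₚ p′ → q ≈ₚ q′ → p ⊕ q ≈ₚ p′ ⊕ q′
  ⊗-cong      : ∀ {p p′ q q′} → p ≈ₚ p′ → q ≈ₚ q′ → p ⊗ q ≈ₚ p′ ⊗ q′
  ⊖-cong      : ∀ {p p′} → p ≈ₚ p′ → ⊖ p ≈ₚ ⊖ p′
  ⊕-assoc     : ∀ p q r → (p ⊕ q) ⊕ r ≈ₚ p ⊕ (q ⊕ r)
  ⊕-comm      : ∀ p q → p ⊕ q ≈ₚ q ⊕ p
  ⊕-identityˡ : ∀ p → con 0ℝ ⊕ p ≈ₚ p
  ⊖-inverseˡ  : ∀ p → ⊖ p ⊕ p ≈ₚ con 0ℝ
  ⊗-assoc     : ∀ p q r → (p ⊗ q) ⊗ r ≈ₚ p ⊗ (q ⊗ r)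
  ⊗-comm      : ∀ p q → p ⊗ q ≈ₚ q ⊗ p
  ⊗-identityˡ : ∀ p → con 1ℝ ⊗ p ≈ₚ p
  ⊗-distribˡ  : ∀ p q r → p ⊗ (q ⊕ r) ≈ₚ (p ⊗ q) ⊕ (p ⊗ r)
  con-cong    : ∀ {a b} → a ≈ℝ b → con a ≈ₚ con b
  con-+       : ∀ a b → con (a +ℝ b) ≈ₚ con a ⊕ con b
  con-*       : ∀ a b → con (a *ℝ b) ≈ₚ con a ⊗ con b

ℝ[_]-commutativeRing : Set → CommutativeRing 0ℓ 0ℓ
ℝ[ V ]-commutativeRing = record
  { Carrier = ℝ[ V ] ; _≈_ = _≈ₚ_ ; _+_ = _⊕_ ; _*_ = _⊗_ ; -_ = ⊖_
  ; 0# = con 0ℝ ; 1# = con 1ℝ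
  ; isCommutativeRing = record
    { isRing = record
      { +-isAbelianGroup = record
        { isGroup = record
          { isMonoid = record
            { isSemigroup = record
              { isMagma = record
                { isEquivalence = record { refl = ≈-refl ; sym = ≈-sym ; trans = ≈-trans }
                ; ∙-cong = ⊕-cong
                }
              ; assoc = ⊕-assoc
              }
            ; identity = ⊕-identityˡ , (λ p → ≈-trans (⊕-comm p _) (⊕-identityˡ p))
            }
          ; inverse = ⊖-inverseˡ , (λ p → ≈-trans (⊕-comm p _) (⊖-inverseˡ p))
          ; ⁻¹-cong = ⊖-cong
          }
        ; comm = ⊕-comm
        }
      ; *-cong = ⊗-cong
      ; *-assoc = ⊗-assoc
      ; *-identity = ⊗-identityˡ , (λ p → ≈-trans (⊗-comm p _) (⊗-identityˡ p))
      ; distrib = ⊗-distribˡ , (λ p q r → ≈-trans (⊗-comm (q ⊕ r) p)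
          (≈-trans (⊗-distribˡ p q r) (⊕-cong (⊗-comm p q) (⊗-comm p r))))
      }
    ; *-comm = ⊗-comm
    }
  }

∑ : ∀ {V} → List ℝ[ V ] → ℝ[ V ]
∑ = List.foldr _⊕_ (con 0ℝ)

substitute : ∀ {V W} → (V → ℝ[ W ]) → ℝ[ V ] → ℝ[ W ]
substitute σ (con a) = con a
substitute σ (var v) = σ v
substitute σ (p ⊕ q) = substitute σ p ⊕ substitute σ q
substitute σ (p ⊗ q) = substitute σ p ⊗ substitute σ q
substitute σ (⊖ p)   = ⊖ substitute σ p

data Homogeneous {V : Set} : ℕ → ℝ[ V ] → Set where
  zero : ∀ {k} → Homogeneous k (con 0ℝ)
  con  : ∀ a → Homogeneous 0 (con a)
  var  : ∀ v → Homogeneous 1 (var v)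
  _⊕_  : ∀ {k p q} → Homogeneous k p → Homogeneous k q → Homogeneous k (p ⊕ q)
  _⊗_  : ∀ {j k p q} → Homogeneous j p → Homogeneous k q → Homogeneous (j ℕ.+ k) (p ⊗ q)
  ⊖_   : ∀ {k p} → Homogeneous k p → Homogeneous k (⊖ p)

-- A matroid on the ground set Fin n, given by its rank function.
record Matroid (n : ℕ) : Set where
  field
    rk            : Subset n → ℕ
    rk-bounded    : ∀ S → rk S ℕ.≤ ∣ S ∣
    rk-monotone   : ∀ {S T} → S ⊆ T → rk S ℕ.≤ rk T
    rk-submodular : ∀ S T → rk (S ∪ T) ℕ.+ rk (S ∩ T) ℕ.≤ rk S ℕ.+ rk T

module _ {n : ℕ} (M : Matroid n) where
  open Matroid M

  IsFlat : Pred (Subset n) 0ℓ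
  IsFlat F = ∀ e → e ∉ F → rk F ℕ.< rk (F ∪ ⁅ e ⁆)

  isFlat? : Decidable IsFlat
  isFlat? F = Fin.all? λ e → ¬? (e ∈? F) →-dec rk F ℕ.<? rk (F ∪ ⁅ e ⁆)

  -- The proof is irrelevant, so that a flat is determined by its set of elements.
  -- The same applies to Between below, whose elements index variables.
  record Flat : Set where
    constructor flat
    field
      elements : Subset n
      .isFlat  : IsFlat elements

open Flat public using (elements)

subsets : ∀ n → List (Subset n)
subsets zero    = [] ∷ []
subsets (suc n) = List.map (outside ∷_) (subsets n) ++ List.map (inside ∷_) (subsets n)

module _ {n : ℕ} {M : Matroid n} where

  infix 4 _<_ _<?_ _⋖_

  _<_ : Rel (Flat M) 0ℓ
  F < G = elements F ⊂ elements G

  _<?_ : Binary.Decidable _<_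
  F <? G = elements F ⊂? elements G

  _⋖_ : Rel (Flat M) 0ℓ
  K ⋖ L = K < L × (∀ F → ¬ (K < F × F < L))

  record Between (K L : Flat M) : Set where
    constructor mkBetween
    field
      ⌊_⌋    : Flat M
      .lower : K < ⌊_⌋
      .upper : ⌊_⌋ < L

  open Between public using (⌊_⌋)

  flats : List (Flat M)
  flats = List.mapMaybe (λ S → Maybe.map (λ h → flat S h) (dec⇒maybe (isFlat? M S))) (subsets n)

  between? : (K L F : Flat M) → Maybe (Between K L)
  between? K L F = Maybe.map (λ { (p , q) → mkBetween F p q }) (dec⇒maybe (K <? F ×-dec F <? L))

  between : (K L : Flat M) → List (Between K L)
  between K L = List.mapMaybe (between? K L) flats

  -- rank K L is the length of a longest chain of flats from K to L; the lattice of
  -- flats being graded, every maximal chain has this length. The recursion has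
  -- bounded depth; rank-recursive below shows that the bound n has no effect.
  rankStep : (Flat M → Flat M → ℕ) → Flat M → Flat M → ℕ
  rankStep r K L = if does (K <? L) then suc (max 0 (List.map (λ F → r ⌊ F ⌋ L) (between K L))) else 0

  rankUpTo : ℕ → Flat M → Flat M → ℕ
  rankUpTo zero    K L = 0
  rankUpTo (suc k) K L = rankStep (rankUpTo k) K L

  rank : Flat M → Flat M → ℕ
  rank = rankUpTo n

  d : Flat M → Flat M → ℕ
  d K L = rank K L ∸ 1

  -- The vector of variables t of ℝ[ Between K L ], extended by t_K = t_L = 0.
  t : (K L : Flat M) → Flat M → ℝ[ Between K L ]
  t K L F = maybe′ var (con 0ℝ) (between? K L F)

  -- The map π from families of coordinates to families indexed by the interval
  -- (F , G). Only the coordinates at flats are kept: no others occur in pol.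
  π : ∀ {V} (F G : Flat M) → (Flat M → ℝ[ V ]) → Between F G → ℝ[ V ]
  π F G t S =
    t ⌊ S ⌋ ⊕ ⊖ (t G ⊗ con (∣ elements ⌊ S ⌋ ─ elements F ∣ ÷ ∣ elements G ─ elements F ∣))
            ⊕ ⊖ (t F ⊗ con (∣ elements G ─ elements ⌊ S ⌋ ∣ ÷ ∣ elements G ─ elements F ∣))

  -- The recursion defining pol is pol ≡ polStep pol, proved below as pol-recursive.
  -- As for rank, its depth is bounded by n.
  polStep : (∀ K L → ℝ[ Between K L ]) → ∀ K L → ℝ[ Between K L ]
  polStep p K L with d K L
  ... | zero  = con 1ℝ
  ... | suc e = con (1 ÷ suc e) ⊗ ∑ (List.map term (between K L))
    where
    term : Between K L → ℝ[ Between K L ]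
    term F = var F ⊗ substitute (π K ⌊ F ⌋ (t K L)) (p K ⌊ F ⌋)
                   ⊗ substitute (π ⌊ F ⌋ L (t K L)) (p ⌊ F ⌋ L)

  polUpTo : ℕ → ∀ K L → ℝ[ Between K L ]
  polUpTo zero    K L = con 1ℝ
  polUpTo (suc k) K L = polStep (polUpTo k) K L

  pol : ∀ K L → ℝ[ Between K L ]
  pol = polUpTo n

  private
    size : Flat M → ℕ
    size F = ∣ elements F ∣

    lower< : ∀ {K L} (F : Between K L) → size K ℕ.< size ⌊ F ⌋
    lower< {K} F@(mkBetween _ p _) = p⊂q⇒∣p∣<∣q∣ (recompute (K <? ⌊ F ⌋) p)

    upper< : ∀ {K L} (F : Between K L) → size ⌊ F ⌋ ℕ.< size L
    upper< {_} {L} F@(mkBetween _ _ q) = p⊂q⇒∣p∣<∣q∣ (recompute (⌊ F ⌋ <? L) q)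

    fuel-lower : ∀ {k K L} (F : Between K L) → size L ℕ.≤ suc k ℕ.+ size K → size ⌊ F ⌋ ℕ.≤ k ℕ.+ size K
    fuel-lower F h = ℕ.s≤s⁻¹ (ℕ.≤-trans (upper< F) h)

    fuel-upper : ∀ {k K L} (F : Between K L) → size L ℕ.≤ suc k ℕ.+ size K → size L ℕ.≤ k ℕ.+ size ⌊ F ⌋
    fuel-upper {k} {K} {L} F h = ℕ.≤-trans h
      (≡.subst (ℕ._≤ k ℕ.+ size ⌊ F ⌋) (ℕ.+-suc k (size K)) (ℕ.+-monoʳ-≤ k (lower< F)))

    fuel-n : ∀ K L → size L ℕ.≤ n ℕ.+ size K
    fuel-n K L = ℕ.≤-trans (∣p∣≤n (elements L)) (ℕ.m≤m+n n (size K))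

    rankStep-0 : ∀ r {K L} → size L ℕ.≤ size K → rankStep r K L ≡ 0
    rankStep-0 r {K} {L} h with K <? L
    ... | yes K<L = contradiction (p⊂q⇒∣p∣<∣q∣ K<L) (ℕ.≤⇒≯ h)
    ... | no  _   = ≡.refl

    rankUpTo-0 : ∀ k {K L} → size L ℕ.≤ size K → rankUpTo k K L ≡ 0
    rankUpTo-0 zero    h = ≡.refl
    rankUpTo-0 (suc k) h = rankStep-0 (rankUpTo k) h

    rankUpTo-stable : ∀ k l {K L} → size L ℕ.≤ k ℕ.+ size K → size L ℕ.≤ l ℕ.+ size K →
                      rankUpTo k K L ≡ rankUpTo l K L
    rankUpTo-stable zero    l       p q = ≡.sym (rankUpTo-0 l p)
    rankUpTo-stable (suc k) zero    p q = rankUpTo-0 (suc k) q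
    rankUpTo-stable (suc k) (suc l) {K} {L} p q =
      ≡.cong (λ rs → if does (K <? L) then suc (max 0 rs) else 0)
        (List.map-cong (λ F → rankUpTo-stable k l (fuel-upper F p) (fuel-upper F q)) (between K L))

    polStep-0 : ∀ p {K L} → size L ℕ.≤ size K → polStep p K L ≡ con 1ℝ
    polStep-0 p {K} {L} h with rank K L | rankUpTo-0 n {K} {L} h
    ... | _ | ≡.refl = ≡.refl

    polUpTo-0 : ∀ k {K L} → size L ℕ.≤ size K → polUpTo k K L ≡ con 1ℝ
    polUpTo-0 zero    h = ≡.refl
    polUpTo-0 (suc k) h = polStep-0 (polUpTo k) h

    polUpTo-stable : ∀ k l {K L} → size L ℕ.≤ k ℕ.+ size K → size L ℕ.≤ l ℕ.+ size K →
                     polUpTo k K L ≡ polUpTo l K L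
    polUpTo-stable zero    l       p q = ≡.sym (polUpTo-0 l p)
    polUpTo-stable (suc k) zero    p q = polUpTo-0 (suc k) q
    polUpTo-stable (suc k) (suc l) {K} {L} p q with d K L
    ... | zero  = ≡.refl
    ... | suc e = ≡.cong (λ ps → con (1 ÷ suc e) ⊗ ∑ ps) (List.map-cong (λ F → ≡.cong₂
        (λ a b → var F ⊗ substitute (π K ⌊ F ⌋ (t K L)) a ⊗ substitute (π ⌊ F ⌋ L (t K L)) b)
        (polUpTo-stable k l (fuel-lower F p) (fuel-lower F q))
        (polUpTo-stable k l (fuel-upper F p) (fuel-upper F q))) (between K L))

  rank-recursive : ∀ K L → rank K L ≡ rankStep rank K L
  rank-recursive K L = rankUpTo-stable n (suc n) (fuel-n K L) (ℕ.m≤n⇒m≤1+n (fuel-n K L))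

  pol-recursive : ∀ K L → pol K L ≡ polStep pol K L
  pol-recursive K L = polUpTo-stable n (suc n) (fuel-n K L) (ℕ.m≤n⇒m≤1+n (fuel-n K L))

  module _ (K L : Flat M) where

    data IncomparableProduct : Pred ℝ[ Between K L ] 0ℓ where
      incomparable : ∀ F G → elements ⌊ F ⌋ ⊈ elements ⌊ G ⌋ → elements ⌊ G ⌋ ⊈ elements ⌊ F ⌋ →
                     IncomparableProduct (var F ⊗ var G)

    ∑∋ : Fin n → ℝ[ Between K L ]
    ∑∋ i = ∑ (List.map var (List.filter (λ F → i ∈? elements ⌊ F ⌋) (between K L)))

    data LinearForm : Pred ℝ[ Between K L ] 0ℓ where
      linear : ∀ {i j} → i ∈ elements L ─ elements K → j ∈ elements L ─ elements K → i ≢ j →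
               LinearForm (∑∋ i ⊕ ⊖ ∑∋ j)

    open Ideals ℝ[ Between K L ]-commutativeRing

    chowRing : CommutativeRing 0ℓ 0ℓ
    chowRing = quotient (⟨ IncomparableProduct ⟩ +ᴵ ⟨ LinearForm ⟩)

    -- The degree k part of the Chow ring: classes of homogeneous polynomials.
    chowPiece : ℕ → RawLeftModule ℝ 0ℓ 0ℓ
    chowPiece k = record
      { Carrierᴹ = ∃[ p ] Homogeneous {Between K L} k p
      ; _≈ᴹ_ = CommutativeRing._≈_ chowRing on proj₁
      ; _+ᴹ_ = λ { (p , hp) (q , hq) → p ⊕ q , hp ⊕ hq }
      ; _*ₗ_ = λ { a (p , hp) → con a ⊗ p , con a ⊗ hp }
      ; 0ᴹ = con 0ℝ , zero
      ; -ᴹ_ = λ { (p , hp) → ⊖ p , ⊖ hp }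
      }

    A : ℕ → Set
    A k = RawLeftModule.Carrierᴹ (chowPiece k)

    flagMonomial : ∀ {k} → Vec (Between K L) k → A k
    flagMonomial []       = con 1ℝ , con 1ℝ
    flagMonomial (F ∷ Fs) = let p , hp = flagMonomial Fs in var F ⊗ p , var F ⊗ hp

    IsMaximalFlag : ∀ {k} → Vec (Between K L) k → Set
    IsMaximalFlag Fs = Linked _⋖_ (K ∷ List.map ⌊_⌋ (Vec.toList Fs) ++ L ∷ [])

    -- The degree isomorphism of the top piece of the Chow ring onto ℝ. It is unique,
    -- the maximal flags spanning the top piece; its existence is a theorem of
    -- Adiprasito, Huh and Katz.
    record DegreeMap : Set where
      field
        deg           : A (d K L) → ℝ
        isIsomorphism : LeftModuleMorphisms.IsLeftModuleIsomorphism
                          (chowPiece (d K L))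
                          (TensorUnit.rawLeftModule {R = CommutativeRing.rawRing ℝ-commutativeRing})
                          deg
        deg-flag      : ∀ (Fs : Vec (Between K L) (d K L)) → IsMaximalFlag Fs →
                        deg (flagMonomial Fs) ≈ℝ 1ℝ

    -- Elements of A_k ⊗ ℝ[t], as formal sums of pure tensors a ⊗ p. The variables x of
    -- the Chow ring and t of ℝ[t] are both written var F; the component of the tensor
    -- tells them apart.
    A[t] : ℕ → Set
    A[t] k = List (A k × ℝ[ Between K L ])

    _·_ : ∀ {j k} → A[t] j → A[t] k → A[t] (j ℕ.+ k)
    _·_ = List.cartesianProductWith λ { ((a , ha) , p) ((b , hb) , q) → (a ⊗ b , ha ⊗ hb) , p ⊗ q }

    ∑xt : A[t] 1
    ∑xt = List.map (λ F → (var F , var F) , var F) (between K L)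

    ∑xt^_ : ∀ k → A[t] k
    ∑xt^ zero  = ((con 1ℝ , con 1ℝ) , con 1ℝ) ∷ []
    ∑xt^ suc k = ∑xt · (∑xt^ k)

    -- The ℝ[t]-linear extension of f, sending a ⊗ p to f(a) p.
    extend : ∀ {k} → (A k → ℝ) → A[t] k → ℝ[ Between K L ]
    extend f u = ∑ (List.map (λ { (a , p) → con (f a) ⊗ p }) u)

    vol : DegreeMap → ℝ[ Between K L ]
    vol D = con (1 ÷ (d K L !)) ⊗ extend (DegreeMap.deg D) (∑xt^ d K L)

{-# OPTIONS --safe #-}

-- The volume polynomial satisfies the recursion defining pol. Multiplying the sum
-- ℓ = ∑ t_G x_G by x_F kills the terms with G incomparable to F, and the linear
-- relations, averaged over all i ∈ F ∖ K and j ∈ L ∖ F, express x_F² through the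
-- remaining products; the result is x_F ℓ = x_F (a + b), where a and b are the sums
-- for the intervals [K , F] and [F , L] with coefficients π_K^F(t) and π_F^L(t).
-- With p = d(K,F), q = d(F,L) the powers a^{p+1} x_F and b^{q+1} x_F vanish, so in
--   ℓ^d = ∑_F t_F x_F (a + b)^{p+q}
-- only the term a^p b^q of the binomial expansion survives, and both factors are
-- evaluated by induction. The induction takes place in an arbitrary ℝ-algebra and
-- carries a multiplier u, the relations of [K , L] being required only after
-- multiplication by u: this way no Chow rings or degree maps of smaller intervals
-- are needed, since those of [K , F] and [F , L] arise from the multiplier x_F u.

module Submission where

open import Algebra.Bundles using (CommutativeRing)
open import Algebra.Module.Morphism.Structures using (module LeftModuleMorphisms)
import Algebra.Properties.AbelianGroup as AbelianGroupProperties
import Algebra.Properties.CommutativeMonoid.Sum as FinSum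
import Algebra.Properties.CommutativeSemigroup as CommutativeSemigroupProperties
import Algebra.Properties.Group as GroupProperties
import Algebra.Properties.Ring as RingProperties
import Algebra.Properties.Semiring.Exp as Exp
import Algebra.Solver.Ring.NaturalCoefficients.Default as SemiringSolver
open import Data.Bool.Base using (true; false; if_then_else_)
import Data.Bool.Properties as Bool
open import Data.Fin.Base using (Fin)
import Data.Fin.Properties as Fin
open import Data.Fin.Subset using (Subset; inside; outside; _∈_; _∉_; _⊆_; _⊈_; _∪_; _∩_; _─_; ⁅_⁆; ∣_∣)
open import Data.Fin.Subset.Properties
import Data.Integer.Base as ℤ
import Data.Integer.Properties as ℤ
open import Data.List.Base as List using (List; []; _∷_; _++_; length)
import Data.List.Extrema.Nat as Extrema
import Data.List.Membership.Propositional as List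
import Data.List.Membership.Propositional.Properties as List
import Data.List.Properties as List
open import Data.List.Relation.Binary.Permutation.Propositional as ↭ using (_↭_)
import Data.List.Relation.Binary.Permutation.Propositional.Properties as ↭
import Data.List.Relation.Unary.All as All
import Data.List.Relation.Unary.All.Properties as All
import Data.List.Relation.Unary.Any as Any
import Data.List.Relation.Unary.Any.Properties as Any
open import Data.List.Relation.Unary.Linked using (Linked; [-]; _∷_)
open import Data.Maybe.Base as Maybe using (Maybe; just; nothing; maybe′)
import Data.Maybe.Relation.Unary.Any as MaybeAny
open import Data.Nat.Base as ℕ using (ℕ; zero; suc; _∸_; _!)
import Data.Nat.Properties as ℕ
open import Data.Product.Base using (∃-syntax; _×_; _,_; proj₁; proj₂)
open import Data.Rational.Base as ℚ using (ℚ)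
import Data.Rational.Properties as ℚ
import Data.Rational.Unnormalised.Base as ℚᵘ
import Data.Rational.Unnormalised.Properties as ℚᵘ
open import Data.Sum.Base using (_⊎_; inj₁; inj₂; [_,_]′)
open import Data.Vec.Base as Vec using (Vec; []; _∷_; lookup)
import Data.Vec.Properties as Vec
open import Function.Base using (_∘_; id)
open import Level using (0ℓ)
open import Relation.Binary.PropositionalEquality as ≡ using (_≡_; _≢_)
import Relation.Binary.Reasoning.Setoid as SetoidReasoning
open import Relation.Nullary using (¬_; Dec; yes; no; contradiction)
open import Relation.Nullary.Decidable using (¬?; _→-dec_; _×-dec_; dec⇒maybe; recompute; decidable-stable)

open import Defs

-- The degree map is given only on homogeneous polynomials of the single degree d, and coefficients
-- in ℝ[t] occur only in formal sums, so the data contain no ring in which ℓ lives. The algebra to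
-- which the induction is applied is built from the functional itself: `deg` is recorded by its
-- values on monomials in x, ℝ[t][x] acts on such functionals by contraction, and a polynomial
-- counts as zero when it annihilates the degree functional. An equation there is tested against
-- each monomial in x, where it becomes an equation between values of `deg`. In particular all
-- maximal flags become equal: each has degree 1, and every further variable leads beyond the top
-- degree. For a^p b^q x_F the two intervals are not evaluated independently. The upper one comes
-- first, after multiplication by an arbitrary maximal flag of the lower one; the value does not
-- depend on that flag, and so it serves as the class of a point for the lower interval.

-- Finite subsets and their enumeration.

∪-least : ∀ {n} {S T U : Subset n} → S ⊆ U → T ⊆ U → S ∪ T ⊆ U
∪-least {S = S} {T} S⊆U T⊆U = [ S⊆U , T⊆U ]′ ∘ x∈p∪q⁻ S T

⁅⁆-⊆ : ∀ {n} {e : Fin n} {S : Subset n} → e ∈ S → ⁅ e ⁆ ⊆ S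
⁅⁆-⊆ {e = e} {S} e∈S x∈ = ≡.subst (_∈ S) (≡.sym (x∈⁅y⁆⇒x≡y e x∈)) e∈S

∈⇒∣∣≡suc : ∀ {n} {S : Subset n} {i} → i ∈ S → ∃[ m ] ∣ S ∣ ≡ suc m
∈⇒∣∣≡suc {S = S} {i} i∈S with ∣ S ∣ | ≡.subst (ℕ._≤ ∣ S ∣) (∣⁅x⁆∣≡1 i) (p⊆q⇒∣p∣≤∣q∣ (⁅⁆-⊆ {S = S} i∈S))
... | suc m | _ = m , ≡.refl

-- Removing `T` a second time would remove `i` and make `S ─ T` smaller, but it changes nothing.
∈─⇒∉ : ∀ {n} (S T : Subset n) {i} → i ∈ S ─ T → i ∉ T
∈─⇒∉ S T {i} i∈ i∈T = ℕ.<-irrefl (≡.cong ∣_∣ (p─q─q≡p─q S T)) (p∩q≢∅⇒∣p─q∣<∣p∣ (S ─ T) T (i , x∈p∩q⁺ (i∈ , i∈T)))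

subsets-complete : ∀ {n} (S : Subset n) → S List.∈ subsets n
subsets-complete []            = Any.here ≡.refl
subsets-complete (outside ∷ S) = List.∈-++⁺ˡ (List.∈-map⁺ (outside ∷_) (subsets-complete S))
subsets-complete (inside ∷ S)  =
  List.∈-++⁺ʳ (List.map (outside ∷_) (subsets _)) (List.∈-map⁺ (inside ∷_) (subsets-complete S))

dec⇒maybe-∈ : ∀ {A : Set} (a? : Dec A) → A → ∃[ a ] dec⇒maybe a? ≡ just a
dec⇒maybe-∈ (yes a) _ = a , ≡.refl
dec⇒maybe-∈ (no ¬a) a = contradiction a ¬a

∈-mapMaybe : ∀ {A B : Set} (f : A → Maybe B) {x y xs} → x List.∈ xs → f x ≡ just y → y List.∈ List.mapMaybe f xs
∈-mapMaybe f {x} {y} {xs} x∈ eq = Any.mapMaybe⁺ f xs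
  (Any.map⁺ (Any.map (λ { ≡.refl → ≡.subst (MaybeAny.Any (y ≡_)) (≡.sym eq) (MaybeAny.just ≡.refl) }) x∈))

-- The lattice of flats: closures, rank differences and maximal chains.

module _ {n : ℕ} {M : Matroid n} where
  open Matroid M

  rkF : Flat M → ℕ
  rkF F = rk (elements F)

  flat-≡ : {F G : Flat M} → elements F ≡ elements G → F ≡ G
  flat-≡ ≡.refl = ≡.refl

  isFlat : (F : Flat M) → IsFlat M (elements F)
  isFlat (flat S h) = recompute (isFlat? M S) h

  <-trans : {F G H : Flat M} → F < G → G < H → F < H
  <-trans {F} {G} {H} = ⊂-trans {i = elements F} {elements G} {elements H}

  <-irrefl : {F : Flat M} → ¬ F < F
  <-irrefl (_ , _ , e∈F , e∉F) = e∉F e∈F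

  between?-≡ : ∀ {K L : Flat M} (F : Between K L) → between? K L ⌊ F ⌋ ≡ just F
  between?-≡ {K} {L} F@(mkBetween G p q)
    with dec⇒maybe-∈ (K <? G ×-dec G <? L) (recompute (K <? G) p , recompute (G <? L) q)
  ... | _ , eq rewrite eq = ≡.refl

  between?-nothing : ∀ {K L F : Flat M} → ¬ (K < F × F < L) → between? K L F ≡ nothing
  between?-nothing {K} {L} {F} ¬p with K <? F ×-dec F <? L
  ... | yes p = contradiction p ¬p
  ... | no  _ = ≡.refl

  lower< : ∀ {K L : Flat M} (F : Between K L) → K < ⌊ F ⌋
  lower< {K} (mkBetween G p q) = recompute (K <? G) p

  upper< : ∀ {K L : Flat M} (F : Between K L) → ⌊ F ⌋ < L
  upper< {_} {L} (mkBetween G p q) = recompute (G <? L) q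

  flats-complete : (F : Flat M) → F List.∈ flats
  flats-complete F with dec⇒maybe-∈ (isFlat? M (elements F)) (isFlat F)
  ... | h , eq = ∈-mapMaybe _ (subsets-complete (elements F)) (≡.cong (Maybe.map (λ h → flat (elements F) h)) eq)

  between-complete : ∀ {K L : Flat M} (F : Between K L) → F List.∈ between K L
  between-complete F = ∈-mapMaybe _ (flats-complete ⌊ F ⌋) (between?-≡ F)

  <⇒rk< : ∀ {F G : Flat M} → F < G → rkF F ℕ.< rkF G
  <⇒rk< {F} {G} (F⊆G , e , e∈G , e∉F) =
    ℕ.<-≤-trans (isFlat F e e∉F) (rk-monotone (∪-least F⊆G (⁅⁆-⊆ e∈G)))

  -- Elements that do not increase the rank are added until none is left; k bounds their number.
  span : ∀ k S → n ℕ.≤ k ℕ.+ ∣ S ∣ → ∃[ F ] (S ⊆ elements {M = M} F × rkF F ≡ rk S)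
  span k S h with isFlat? M S
  ... | yes S-flat = flat S S-flat , id , ≡.refl
  ... | no  ¬flat
    with e , ¬p ← Fin.¬∀⟶∃¬ n _ (λ e → ¬? (e ∈? S) →-dec rk S ℕ.<? rk (S ∪ ⁅ e ⁆)) ¬flat
    = grow k h
    where
    e∉S : e ∉ S
    e∉S e∈S = ¬p (λ e∉S → contradiction e∈S e∉S)
    S⁺ = S ∪ ⁅ e ⁆
    S⊆S⁺ : S ⊆ S⁺
    S⊆S⁺ = p⊆p∪q {p = S} ⁅ e ⁆
    bigger : ∣ S ∣ ℕ.< ∣ S⁺ ∣
    bigger = p⊂q⇒∣p∣<∣q∣ (S⊆S⁺ , e , q⊆p∪q S ⁅ e ⁆ (x∈⁅x⁆ e) , e∉S)
    same : rk S⁺ ≡ rk S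
    same = ℕ.≤-antisym (ℕ.≮⇒≥ (λ lt → ¬p (λ _ → lt))) (rk-monotone S⊆S⁺)
    grow : ∀ k → n ℕ.≤ k ℕ.+ ∣ S ∣ → ∃[ F ] (S ⊆ elements {M = M} F × rkF F ≡ rk S)
    grow zero    h = contradiction (ℕ.<-≤-trans bigger (∣p∣≤n S⁺)) (ℕ.≤⇒≯ h)
    grow (suc k) h
      with F , S⁺⊆F , eq ← span k S⁺ (ℕ.≤-trans h (≡.subst (ℕ._≤ k ℕ.+ ∣ S⁺ ∣) (ℕ.+-suc k ∣ S ∣) (ℕ.+-monoʳ-≤ k bigger)))
      = F , S⁺⊆F ∘ S⊆S⁺ , ≡.trans eq same

  -- Since `F ∩ L` contains `S`, its rank is at least that of `F`, and submodularity bounds the rank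
  -- of `F ∪ L` by that of `L`. An element of `F` outside the flat `L` would raise this rank.
  span-⊆ : ∀ {S} (F L : Flat M) → S ⊆ elements F → rkF F ≡ rk S → S ⊆ elements L → elements F ⊆ elements L
  span-⊆ {S} F L S⊆F eq S⊆L {e} e∈F = decidable-stable (e ∈? elements L) λ e∉L →
    ℕ.<⇒≱ (isFlat L e e∉L) (ℕ.≤-trans (rk-monotone L∪e⊆F∪L) (ℕ.+-cancelʳ-≤ (rkF F) _ _ (begin
      rk (elements F ∪ elements L) ℕ.+ rkF F                             ≤⟨ ℕ.+-monoʳ-≤ _ (ℕ.≤-trans (ℕ.≤-reflexive eq) (rk-monotone S⊆F∩L)) ⟩
      rk (elements F ∪ elements L) ℕ.+ rk (elements F ∩ elements L)      ≤⟨ rk-submodular (elements F) (elements L) ⟩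
      rkF F ℕ.+ rkF L                                                    ≡⟨ ℕ.+-comm (rkF F) (rkF L) ⟩
      rkF L ℕ.+ rkF F                                                    ∎)))
    where
    open ℕ.≤-Reasoning
    L∪e⊆F∪L : elements L ∪ ⁅ e ⁆ ⊆ elements F ∪ elements L
    L∪e⊆F∪L = ∪-least (q⊆p∪q (elements F) (elements L)) (⁅⁆-⊆ (p⊆p∪q {p = elements F} (elements L) e∈F))
    S⊆F∩L : S ⊆ elements F ∩ elements L
    S⊆F∩L x∈S = x∈p∩q⁺ (S⊆F x∈S , S⊆L x∈S)

  -- `F` is the closure of `K` with one element of `L` added; submodularity lets the rank grow by at
  -- most one. The inclusion in `L` is not strict because `F` is `L` itself when `L` covers `K`.
  atom : ∀ {K L : Flat M} → K < L → ∃[ F ] (K < F × elements F ⊆ elements L × rkF F ≡ suc (rkF K))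
  atom {K} {L} (K⊆L , e , e∈L , e∉K)
    with F , S⊆F , eq ← span n (elements K ∪ ⁅ e ⁆) (ℕ.m≤m+n n _)
    = F , K<F , span-⊆ F L S⊆F eq (∪-least K⊆L (⁅⁆-⊆ e∈L)) , ℕ.≤-antisym rk≤ (<⇒rk< {K} {F} K<F)
    where
    S = elements K ∪ ⁅ e ⁆
    K<F : K < F
    K<F = S⊆F ∘ p⊆p∪q {p = elements K} ⁅ e ⁆ , e , S⊆F (q⊆p∪q (elements K) ⁅ e ⁆ (x∈⁅x⁆ e)) , e∉K
    rk≤ : rkF F ℕ.≤ suc (rkF K)
    rk≤ = begin
      rkF F                                      ≡⟨ eq ⟩
      rk S                                       ≤⟨ ℕ.m≤m+n (rk S) _ ⟩
      rk S ℕ.+ rk (elements K ∩ ⁅ e ⁆)           ≤⟨ rk-submodular (elements K) ⁅ e ⁆ ⟩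
      rkF K ℕ.+ rk ⁅ e ⁆                         ≤⟨ ℕ.+-monoʳ-≤ (rkF K) (rk-bounded ⁅ e ⁆) ⟩
      rkF K ℕ.+ ∣ ⁅ e ⁆ ∣                        ≡⟨ ≡.cong (rkF K ℕ.+_) (∣⁅x⁆∣≡1 e) ⟩
      rkF K ℕ.+ 1                                ≡⟨ ℕ.+-comm (rkF K) 1 ⟩
      suc (rkF K)                                ∎
      where open ℕ.≤-Reasoning

  ⊆-rk : ∀ {F L : Flat M} → elements F ⊆ elements L → rkF F ℕ.< rkF L → F < L
  ⊆-rk {F} {L} F⊆L lt with F <? L
  ... | yes F<L = F<L
  ... | no  F≮L = contradiction lt (ℕ.≤⇒≯ (rk-monotone {elements L} {elements F} λ {e} e∈L →
          decidable-stable (e ∈? elements F) λ e∉F → F≮L (F⊆L , e , e∈L , e∉F)))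

  atom-between : ∀ {K L : Flat M} → K < L → suc (rkF K) ℕ.< rkF L → ∃[ F ] (rkF ⌊ F ⌋ ≡ suc (rkF K) × K < ⌊ F ⌋ × ⌊_⌋ {K = K} {L} F < L)
  atom-between {K} {L} K<L lt with atom {K} {L} K<L
  ... | F , K<F , F⊆L , eq = mkBetween F K<F F<L , eq , K<F , F<L
    where F<L = ⊆-rk {F} {L} F⊆L (≡.subst (ℕ._< rkF L) (≡.sym eq) lt)

  ⋖⇒rk : ∀ {K L : Flat M} → K ⋖ L → rkF L ≡ suc (rkF K)
  ⋖⇒rk {K} {L} (K<L , none) = ℕ.≤-antisym
    (ℕ.≮⇒≥ λ lt → let F , _ , p , q = atom-between {K} {L} K<L lt in none ⌊ F ⌋ (p , q))
    (<⇒rk< {K} {L} K<L)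

  rk⇒⋖ : ∀ {K L : Flat M} → K < L → rkF L ≡ suc (rkF K) → K ⋖ L
  rk⇒⋖ {K} {L} K<L eq = K<L , λ F (K<F , F<L) →
    ℕ.<⇒≱ (<⇒rk< {F} {L} F<L) (ℕ.≤-trans (ℕ.≤-reflexive eq) (<⇒rk< {K} {F} K<F))

  -- By induction the maximum in the recursion for `rank` runs over the numbers `rkF L ∸ rkF F`. It
  -- is attained at a flat of rank `suc (rkF K)`, which `atom-between` supplies. From here on chain
  -- lengths are differences of matroid ranks and hence additive.
  rank-∸ : ∀ {K L : Flat M} → K < L → rank K L ≡ rkF L ∸ rkF K
  rank-∸ {K} {L} = go (rkF L) (ℕ.m≤m+n (rkF L) (rkF K))
    where
    go : ∀ k {K} → rkF L ℕ.≤ k ℕ.+ rkF K → K < L → rank K L ≡ rkF L ∸ rkF K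
    go zero    {K} h K<L = contradiction (<⇒rk< {K} {L} K<L) (ℕ.≤⇒≯ h)
    go (suc k) {K} h K<L rewrite rank-recursive K L with K <? L
    ... | no  K≮L = contradiction K<L K≮L
    ... | yes _   = ≡.trans (≡.cong suc {max} {r} (ℕ.≤-antisym upper lower)) (ℕ.suc-pred (rkF L ∸ rkF K) ⦃ ℕ.>-nonZero (ℕ.m<n⇒0<n∸m rk<) ⦄)
      where
      rk< : rkF K ℕ.< rkF L
      rk< = <⇒rk< {K} {L} K<L
      ranks = List.map (λ F → rank ⌊ F ⌋ L) (between K L)
      max = Extrema.max 0 ranks
      r = ℕ.pred (rkF L ∸ rkF K)
      step : (F : Between K L) → rank ⌊ F ⌋ L ≡ rkF L ∸ rkF ⌊ F ⌋
      step F = go k (ℕ.≤-trans h (≡.subst (ℕ._≤ k ℕ.+ rkF ⌊ F ⌋) (ℕ.+-suc k (rkF K)) (ℕ.+-monoʳ-≤ k (<⇒rk< {K} {⌊ F ⌋} (lower< F))))) (upper< F)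
      ∸-suc : rkF L ∸ suc (rkF K) ≡ r
      ∸-suc = ≡.sym (ℕ.pred[m∸n]≡m∸[1+n] (rkF L) (rkF K))
      upper : max ℕ.≤ r
      upper = Extrema.max≤v⁺ {⊥ = 0} {xs = ranks} ℕ.z≤n (All.map⁺ (All.universal (λ F → begin
        rank ⌊ F ⌋ L             ≡⟨ step F ⟩
        rkF L ∸ rkF ⌊ F ⌋        ≤⟨ ℕ.∸-monoʳ-≤ (rkF L) (<⇒rk< {K} {⌊ F ⌋} (lower< F)) ⟩
        rkF L ∸ suc (rkF K)      ≡⟨ ∸-suc ⟩
        r                        ∎) (between K L)))
        where open ℕ.≤-Reasoning
      lower : r ℕ.≤ max
      lower with suc (rkF K) ℕ.<? rkF L
      -- `L` has rank at most `suc (rkF K)`, so `r` is 0, the default value of the maximum.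
      ... | no  ≮ = ≡.subst (ℕ._≤ max) (≡.trans (≡.sym (ℕ.m≤n⇒m∸n≡0 (ℕ.≮⇒≥ ≮))) ∸-suc) ℕ.z≤n
      ... | yes lt with F , eq , _ ← atom-between {K} {L} K<L lt =
        Extrema.v≤max⁺ 0 ranks (inj₂ (Any.map⁺ (Any.map (λ { ≡.refl → ℕ.≤-reflexive (≡.sym (≡.trans (step F) (≡.trans (≡.cong (rkF L ∸_) eq) ∸-suc))) }) (between-complete F))))

  rk-d : ∀ {K L : Flat M} → K < L → rkF L ≡ suc (d K L) ℕ.+ rkF K
  rk-d {K} {L} K<L rewrite rank-∸ {K} {L} K<L = ≡.sym (≡.trans
    (≡.cong (ℕ._+ rkF K) (≡.trans (ℕ.+-comm 1 (rkF L ∸ rkF K ∸ 1)) (ℕ.m∸n+n≡m (ℕ.m<n⇒0<n∸m (<⇒rk< {K} {L} K<L)))))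
    (ℕ.m∸n+n≡m (ℕ.<⇒≤ (<⇒rk< {K} {L} K<L))))

  -- The additional one is the degree of the variable x_F itself.
  d-split : ∀ {K F L : Flat M} → K < F → F < L → d K L ≡ suc (d K F ℕ.+ d F L)
  d-split {K} {F} {L} K<F F<L = ℕ.suc-injective (ℕ.+-cancelʳ-≡ (rkF K) _ _ (begin
    suc (d K L) ℕ.+ rkF K                         ≡⟨ rk-d {K} {L} (<-trans {K} {F} {L} K<F F<L) ⟨
    rkF L                                         ≡⟨ rk-d {F} {L} F<L ⟩
    suc (d F L) ℕ.+ rkF F                         ≡⟨ ≡.cong (suc (d F L) ℕ.+_) (rk-d {K} {F} K<F) ⟩
    suc (d F L) ℕ.+ (suc (d K F) ℕ.+ rkF K)       ≡⟨ ℕ.+-assoc (suc (d F L)) _ _ ⟨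
    suc (d F L) ℕ.+ suc (d K F) ℕ.+ rkF K         ≡⟨ ≡.cong (ℕ._+ rkF K) (ℕ.+-comm (suc (d F L)) (suc (d K F))) ⟩
    suc (d K F) ℕ.+ suc (d F L) ℕ.+ rkF K         ≡⟨ ≡.cong (λ k → suc k ℕ.+ rkF K) (ℕ.+-suc (d K F) (d F L)) ⟩
    suc (suc (d K F ℕ.+ d F L)) ℕ.+ rkF K         ∎))
    where open ≡.≡-Reasoning

  -- The shape of `IsMaximalFlag`, but with flats instead of members of `Between K L`: chains of
  -- [K , F] and [F , L] can then be joined without changing the index type of their entries.
  MaximalChain : Flat M → List (Flat M) → Flat M → Set
  MaximalChain K Fs L = Linked _⋖_ (K ∷ Fs ++ L ∷ [])

  chain-++ : ∀ {K F L} Fs {Gs} → MaximalChain K Fs F → MaximalChain F Gs L → MaximalChain K (Fs ++ F ∷ Gs) L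
  chain-++ []       (c ∷ [-]) c′ = c ∷ c′
  chain-++ (_ ∷ Fs) (c ∷ cs)  c′ = c ∷ chain-++ Fs cs c′

  chain-< : ∀ {K L} Fs → MaximalChain K Fs L → K < L
  chain-< []       (c ∷ [-]) = proj₁ c
  chain-< {K} {L} (F ∷ Fs) (c ∷ cs)  = <-trans {K} {F} {L} (proj₁ c) (chain-< Fs cs)

  chain-rk : ∀ {K L} Fs → MaximalChain K Fs L → rkF L ≡ suc (length Fs) ℕ.+ rkF K
  chain-rk {K} {L} []       (c ∷ [-]) = ⋖⇒rk {K} {L} c
  chain-rk {K} {L} (F ∷ Fs) (c ∷ cs)  = ≡.trans (chain-rk Fs cs)
    (≡.trans (≡.cong (suc (length Fs) ℕ.+_) (⋖⇒rk {K} {F} c)) (ℕ.+-suc (suc (length Fs)) (rkF K)))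

  chain-length : ∀ {K L} Fs → MaximalChain K Fs L → length Fs ≡ d K L
  chain-length {K} {L} Fs c = ℕ.suc-injective (ℕ.+-cancelʳ-≡ (rkF K) _ _
    (≡.trans (≡.sym (chain-rk Fs c)) (rk-d {K} {L} (chain-< Fs c))))

  ⊆-≡ : ∀ {F L : Flat M} → elements F ⊆ elements L → ¬ F < L → F ≡ L
  ⊆-≡ {F} {L} F⊆L F≮L = flat-≡ (⊆-antisym F⊆L λ {e} e∈L →
    decidable-stable (e ∈? elements F) λ e∉F → F≮L (F⊆L , e , e∈L , e∉F))

  chain-exists : ∀ {K L : Flat M} → K < L → ∃[ Fs ] MaximalChain K Fs L
  chain-exists {K} {L} = go (rkF L) (ℕ.m≤m+n (rkF L) (rkF K))
    where
    go : ∀ k {K} → rkF L ℕ.≤ k ℕ.+ rkF K → K < L → ∃[ Fs ] MaximalChain K Fs L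
    go zero    {K} h K<L = contradiction (<⇒rk< {K} {L} K<L) (ℕ.≤⇒≯ h)
    go (suc k) {K} h K<L with F , K<F , F⊆L , eq ← atom {K} {L} K<L with F <? L
    ... | no  F≮L with ≡.refl ← ⊆-≡ {F} {L} F⊆L F≮L = [] , rk⇒⋖ {K} {F} K<F eq ∷ [-]
    ... | yes F<L with Fs , c ← go k {F} (≡.subst (rkF L ℕ.≤_) (≡.sym (≡.trans (≡.cong (k ℕ.+_) eq) (ℕ.+-suc k (rkF K)))) h) F<L
        = F ∷ Fs , rk⇒⋖ {K} {F} K<F eq ∷ c

  chain-between : ∀ {K L : Flat M} Fs → MaximalChain K Fs L → ∃[ Bs ] List.map (⌊_⌋ {K = K} {L}) Bs ≡ Fs
  chain-between {K} {L} Fs c = go Fs c (λ { K<F F<L → K<F })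
    where
    -- The lower end `J` moves up the chain; the last argument remembers that what lies between `J`
    -- and `L` is still above `K`.
    go : ∀ {J} Fs → MaximalChain J Fs L → (∀ {F} → J < F → F < L → K < F) → ∃[ Bs ] List.map (⌊_⌋ {K = K} {L}) Bs ≡ Fs
    go []       c _ = [] , ≡.refl
    go (F ∷ Fs) (c ∷ cs) below with F<L ← chain-< Fs cs
      with Bs , ≡.refl ← go Fs cs (λ {G} F<G G<L → <-trans {K} {F} {G} (below {F} (proj₁ c) F<L) F<G)
      = mkBetween F (below {F} (proj₁ c) F<L) F<L ∷ Bs , ≡.refl

-- Arithmetic of fractions.

/-toℚᵘ : ∀ a m → ℚ.toℚᵘ (ℤ.+ a ℚ./ suc m) ℚᵘ.≃ ℚᵘ.mkℚᵘ (ℤ.+ a) m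
/-toℚᵘ a m = ℚ.toℚᵘ-fromℚᵘ (ℚᵘ.mkℚᵘ (ℤ.+ a) m)

/1-+ : ∀ a b → ℤ.+ (a ℕ.+ b) ℚ./ 1 ≡ ℤ.+ a ℚ./ 1 ℚ.+ ℤ.+ b ℚ./ 1
/1-+ a b = ℚ.toℚᵘ-injective (ℚᵘ.≃-trans (/-toℚᵘ (a ℕ.+ b) 0) (ℚᵘ.≃-sym (ℚᵘ.≃-trans
  (ℚ.toℚᵘ-homo-+ (ℤ.+ a ℚ./ 1) (ℤ.+ b ℚ./ 1)) (ℚᵘ.≃-trans
  (ℚᵘ.+-cong (/-toℚᵘ a 0) (/-toℚᵘ b 0))
  (ℚᵘ.*≡* (≡.cong₂ (λ x y → (x ℤ.+ y) ℤ.* ℤ.1ℤ) (ℤ.*-identityʳ (ℤ.+ a)) (ℤ.*-identityʳ (ℤ.+ b))))))))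

-- One cancellation law for several purposes: with suitable numerators and denominators it gives the
-- multiplicativity of `κ`, the inverse of `κ (suc m)` and the splitting of a fraction into
-- numerator and unit fraction.
/-* : ∀ a b l m → (ℤ.+ a ℚ./ suc l) ℚ.* (ℤ.+ (b ℕ.* suc l) ℚ./ suc m) ≡ ℤ.+ (a ℕ.* b) ℚ./ suc m
/-* a b l m = ℚ.toℚᵘ-injective (ℚᵘ.≃-trans (ℚ.toℚᵘ-homo-* (ℤ.+ a ℚ./ suc l) _) (ℚᵘ.≃-trans
  (ℚᵘ.*-cong (/-toℚᵘ a l) (/-toℚᵘ (b ℕ.* suc l) m)) (ℚᵘ.≃-trans (ℚᵘ.*≡* eq) (ℚᵘ.≃-sym (/-toℚᵘ (a ℕ.* b) m)))))
  where
  open ≡.≡-Reasoning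
  eq : (ℤ.+ a ℤ.* ℤ.+ (b ℕ.* suc l)) ℤ.* ℤ.+ suc m ≡ ℤ.+ (a ℕ.* b) ℤ.* ℤ.+ (suc l ℕ.* suc m)
  eq = begin
    (ℤ.+ a ℤ.* ℤ.+ (b ℕ.* suc l)) ℤ.* ℤ.+ suc m   ≡⟨ ≡.cong (ℤ._* ℤ.+ suc m) (ℤ.pos-* a (b ℕ.* suc l)) ⟨
    ℤ.+ (a ℕ.* (b ℕ.* suc l)) ℤ.* ℤ.+ suc m       ≡⟨ ℤ.pos-* (a ℕ.* (b ℕ.* suc l)) (suc m) ⟨
    ℤ.+ (a ℕ.* (b ℕ.* suc l) ℕ.* suc m)           ≡⟨ ≡.cong (λ x → ℤ.+ (x ℕ.* suc m)) (ℕ.*-assoc a b (suc l)) ⟨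
    ℤ.+ (a ℕ.* b ℕ.* suc l ℕ.* suc m)             ≡⟨ ≡.cong ℤ.+_ (ℕ.*-assoc (a ℕ.* b) (suc l) (suc m)) ⟩
    ℤ.+ (a ℕ.* b ℕ.* (suc l ℕ.* suc m))           ≡⟨ ℤ.pos-* (a ℕ.* b) (suc l ℕ.* suc m) ⟩
    ℤ.+ (a ℕ.* b) ℤ.* ℤ.+ (suc l ℕ.* suc m)       ∎

-- Finite sums over lists, over flats and over intervals.

module ListSum (R : CommutativeRing 0ℓ 0ℓ) where
  open CommutativeRing R
  open CommutativeSemigroupProperties +-commutativeSemigroup using (interchange)

  -- Folded exactly like `∑`, so that over a polynomial ring and over its quotients the two agree by
  -- definition.
  Σ : {A : Set} → List A → (A → Carrier) → Carrier
  Σ xs f = List.foldr _+_ 0# (List.map f xs)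

  module _ {A : Set} where

    Σ-cong : ∀ (xs : List A) {f g} → (∀ a → f a ≈ g a) → Σ xs f ≈ Σ xs g
    Σ-cong []       eq = refl
    Σ-cong (a ∷ xs) eq = +-cong (eq a) (Σ-cong xs eq)

    Σ-0 : ∀ (xs : List A) {f} → (∀ a → f a ≈ 0#) → Σ xs f ≈ 0#
    Σ-0 []       eq = refl
    Σ-0 (a ∷ xs) eq = trans (+-cong (eq a) (Σ-0 xs eq)) (+-identityˡ 0#)

    Σ-+ : ∀ (xs : List A) f g → Σ xs (λ a → f a + g a) ≈ Σ xs f + Σ xs g
    Σ-+ []       f g = sym (+-identityˡ 0#)
    Σ-+ (a ∷ xs) f g = trans (+-congˡ (Σ-+ xs f g)) (interchange (f a) (g a) _ _)

    Σ-*ˡ : ∀ (xs : List A) c f → Σ xs (λ a → c * f a) ≈ c * Σ xs f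
    Σ-*ˡ []       c f = sym (zeroʳ c)
    Σ-*ˡ (a ∷ xs) c f = trans (+-congˡ (Σ-*ˡ xs c f)) (sym (distribˡ c (f a) _))

    Σ-++ : ∀ (xs ys : List A) f → Σ (xs ++ ys) f ≈ Σ xs f + Σ ys f
    Σ-++ []       ys f = sym (+-identityˡ _)
    Σ-++ (a ∷ xs) ys f = trans (+-congˡ (Σ-++ xs ys f)) (sym (+-assoc (f a) _ _))

    Σ-map : ∀ {B : Set} (h : B → A) xs (f : A → Carrier) → Σ (List.map h xs) f ≡ Σ xs (f ∘ h)
    Σ-map h xs f = ≡.cong (List.foldr _+_ 0#) (≡.sym (List.map-∘ xs))

    Σ-mapMaybe : ∀ {B : Set} (h : B → Maybe A) xs (f : A → Carrier) →
                 Σ (List.mapMaybe h xs) f ≈ Σ xs (λ b → maybe′ f 0# (h b))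
    Σ-mapMaybe h []       f = refl
    Σ-mapMaybe h (b ∷ xs) f with h b
    ... | just a  = +-congˡ (Σ-mapMaybe h xs f)
    ... | nothing = trans (Σ-mapMaybe h xs f) (sym (+-identityˡ _))

  -- This is how the absence of repetitions in `subsets` is used: the half of the list with the
  -- wrong first entry contributes zero, and the other half contains the tail of `S` once.
  Σ-subsets : ∀ {n} φ (S : Subset n) → (∀ T → T ≢ S → φ T ≈ 0#) → Σ (subsets n) φ ≈ φ S
  Σ-subsets φ []            h = +-identityʳ (φ [])
  Σ-subsets {suc n} φ (outside ∷ S) h = begin
    Σ (List.map (outside ∷_) (subsets n) ++ List.map (inside ∷_) (subsets n)) φ
      ≈⟨ Σ-++ (List.map (outside ∷_) (subsets n)) _ φ ⟩
    Σ (List.map (outside ∷_) (subsets n)) φ + Σ (List.map (inside ∷_) (subsets n)) φ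
      ≡⟨ ≡.cong₂ _+_ (Σ-map (outside ∷_) (subsets n) φ) (Σ-map (inside ∷_) (subsets n) φ) ⟩
    Σ (subsets n) (φ ∘ (outside ∷_)) + Σ (subsets n) (φ ∘ (inside ∷_))
      ≈⟨ +-cong (Σ-subsets (φ ∘ (outside ∷_)) S (λ T T≢S → h _ (T≢S ∘ Vec.∷-injectiveʳ))) (Σ-0 (subsets n) (λ T → h _ λ ())) ⟩
    φ (outside ∷ S) + 0#
      ≈⟨ +-identityʳ _ ⟩
    φ (outside ∷ S)
      ∎
    where open SetoidReasoning setoid
  Σ-subsets {suc n} φ (inside ∷ S) h = begin
    Σ (List.map (outside ∷_) (subsets n) ++ List.map (inside ∷_) (subsets n)) φ
      ≈⟨ Σ-++ (List.map (outside ∷_) (subsets n)) _ φ ⟩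
    Σ (List.map (outside ∷_) (subsets n)) φ + Σ (List.map (inside ∷_) (subsets n)) φ
      ≡⟨ ≡.cong₂ _+_ (Σ-map (outside ∷_) (subsets n) φ) (Σ-map (inside ∷_) (subsets n) φ) ⟩
    Σ (subsets n) (φ ∘ (outside ∷_)) + Σ (subsets n) (φ ∘ (inside ∷_))
      ≈⟨ +-cong (Σ-0 (subsets n) (λ T → h _ λ ())) (Σ-subsets (φ ∘ (inside ∷_)) S (λ T T≢S → h _ (T≢S ∘ Vec.∷-injectiveʳ))) ⟩
    0# + φ (inside ∷ S)
      ≈⟨ +-identityˡ _ ⟩
    φ (inside ∷ S)
      ∎
    where open SetoidReasoning setoid

  module _ {n : ℕ} {M : Matroid n} where

    Σ-flats : ∀ g (F : Flat M) → (∀ G → G ≢ F → g G ≈ 0#) → Σ flats g ≈ g F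
    Σ-flats g F h = trans (Σ-mapMaybe toFlat (subsets n) g)
      (trans (Σ-subsets φ (elements F) off) (reflexive on))
      where
      toFlat : Subset n → Maybe (Flat M)
      toFlat S = Maybe.map (λ S-flat → flat S S-flat) (dec⇒maybe (isFlat? M S))
      φ : Subset n → Carrier
      φ S = maybe′ g 0# (toFlat S)
      off : ∀ S → S ≢ elements F → φ S ≈ 0#
      off S S≢F with isFlat? M S
      ... | yes S-flat = h (flat S S-flat) (S≢F ∘ ≡.cong elements)
      ... | no  _      = refl
      on : φ (elements F) ≡ g F
      on with isFlat? M (elements F)
      ... | yes _  = ≡.refl
      ... | no  ¬f = contradiction (isFlat F) ¬f

    -- Extension by zero outside the interval. Sums over different intervals thereby get the common
    -- index list `flats` and can be compared term by term.
    restrict : (K L : Flat M) → (Flat M → Carrier) → Flat M → Carrier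
    restrict K L g G = maybe′ (g ∘ ⌊_⌋) 0# (between? K L G)

    restrict-in : ∀ {K L G} g → K < G → G < L → restrict K L g G ≡ g G
    restrict-in {K} {L} {G} g p q = ≡.cong (maybe′ (g ∘ ⌊_⌋) 0#) (between?-≡ (mkBetween G p q))

    restrict-out : ∀ {K L G} g → ¬ (K < G × G < L) → restrict K L g G ≡ 0#
    restrict-out {K} {L} {G} g ¬p = ≡.cong (maybe′ (g ∘ ⌊_⌋) 0#) (between?-nothing {K = K} {L} {G} ¬p)

    Σ-restrict : ∀ (K L : Flat M) g → Σ (between K L) (g ∘ ⌊_⌋) ≈ Σ flats (restrict K L g)
    Σ-restrict K L g = Σ-mapMaybe (between? K L) flats (g ∘ ⌊_⌋)

    -- Over `flats` the claim is pointwise: a flat between `K` and `L` is below `F`, equal to `F`,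
    -- above `F`, or incomparable to `F` and then contributes zero. The term at `F` is carried by a
    -- delta function, which `Σ-flats` sums to a single value.
    Σ-split : ∀ (K F L : Flat M) g → K < F → F < L →
              (∀ G → K < G → G < L → elements G ⊈ elements F → elements F ⊈ elements G → g G ≈ 0#) →
              Σ (between K L) (g ∘ ⌊_⌋) ≈ (Σ (between K F) (g ∘ ⌊_⌋) + g F) + Σ (between F L) (g ∘ ⌊_⌋)
    Σ-split K F L g K<F F<L incomp = begin
      Σ (between K L) (g ∘ ⌊_⌋)
        ≈⟨ Σ-restrict K L g ⟩
      Σ flats (restrict K L g)
        ≈⟨ Σ-cong flats pointwise ⟩
      Σ flats (λ G → (restrict K F g G + δ G) + restrict F L g G)
        ≈⟨ trans (Σ-+ flats (λ G → restrict K F g G + δ G) _) (+-congʳ (Σ-+ flats (restrict K F g) δ)) ⟩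
      (Σ flats (restrict K F g) + Σ flats δ) + Σ flats (restrict F L g)
        ≈⟨ +-cong (+-cong (sym (Σ-restrict K F g)) (trans (Σ-flats δ F (λ G G≢F → reflexive (δ-off G≢F))) (reflexive δ-on))) (sym (Σ-restrict F L g)) ⟩
      (Σ (between K F) (g ∘ ⌊_⌋) + g F) + Σ (between F L) (g ∘ ⌊_⌋)
        ∎
      where
      open SetoidReasoning setoid
      _≟_ : (S T : Subset n) → _
      _≟_ = Vec.≡-dec Bool._≟_
      δ : Flat M → Carrier
      δ G with elements G ≟ elements F
      ... | yes _ = g F
      ... | no  _ = 0#
      δ-on : δ F ≡ g F
      δ-on with elements F ≟ elements F
      ... | yes _  = ≡.refl
      ... | no  ≢F = contradiction ≡.refl ≢F
      δ-off : ∀ {G} → G ≢ F → δ G ≡ 0#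
      δ-off {G} G≢F with elements G ≟ elements F
      ... | yes eq = contradiction (flat-≡ eq) G≢F
      ... | no  _  = ≡.refl
      add : ∀ {w a b c} {x y z : Carrier} → a ≡ x → b ≡ y → c ≡ z → w ≈ (x + y) + z → w ≈ (a + b) + c
      add ≡.refl ≡.refl ≡.refl eq = eq
      ooz : ∀ x → x ≈ (0# + 0#) + x
      ooz x = sym (trans (+-congʳ (+-identityˡ 0#)) (+-identityˡ x))
      oyo : ∀ x → x ≈ (0# + x) + 0#
      oyo x = sym (trans (+-identityʳ _) (+-identityˡ x))
      xoo : ∀ x → x ≈ (x + 0#) + 0#
      xoo x = sym (trans (+-identityʳ _) (+-identityʳ x))
      cases : ∀ G → Dec (elements G ≡ elements F) → Dec (K < G) → Dec (G < L) → Dec (G < F) → Dec (F < G) →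
              restrict K L g G ≈ (restrict K F g G + δ G) + restrict F L g G
      cases G (yes eq) _ _ _ _ with ≡.refl ← flat-≡ {F = G} {F} eq = add
        (restrict-out {K} {F} {F} g (λ p → <-irrefl {F = F} (proj₂ p))) δ-on (restrict-out {F} {L} {F} g (λ p → <-irrefl {F = F} (proj₁ p)))
        (trans (reflexive (restrict-in {K} {L} {F} g K<F F<L)) (oyo (g F)))
      cases G (no ≢F) (no K≮G) _ _ _ = add
        (restrict-out {K} {F} {G} g (K≮G ∘ proj₁)) (δ-off (≢F ∘ ≡.cong elements))
        (restrict-out {F} {L} {G} g (λ p → K≮G (<-trans {F = K} {F} {G} K<F (proj₁ p))))
        (trans (reflexive (restrict-out {K} {L} {G} g (K≮G ∘ proj₁))) (ooz 0#))
      cases G (no ≢F) (yes _) (no G≮L) _ _ = add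
        (restrict-out {K} {F} {G} g (λ p → G≮L (<-trans {F = G} {F} {L} (proj₂ p) F<L))) (δ-off (≢F ∘ ≡.cong elements))
        (restrict-out {F} {L} {G} g (G≮L ∘ proj₂))
        (trans (reflexive (restrict-out {K} {L} {G} g (G≮L ∘ proj₂))) (ooz 0#))
      cases G (no ≢F) (yes K<G) (yes G<L) (yes G<F) _ = add
        (restrict-in {K} {F} {G} g K<G G<F) (δ-off (≢F ∘ ≡.cong elements))
        (restrict-out {F} {L} {G} g (λ p → <-irrefl {F = F} (<-trans {F = F} {G} {F} (proj₁ p) G<F)))
        (trans (reflexive (restrict-in {K} {L} {G} g K<G G<L)) (xoo (g G)))
      cases G (no ≢F) (yes K<G) (yes G<L) (no G≮F) (yes F<G) = add
        (restrict-out {K} {F} {G} g (G≮F ∘ proj₂)) (δ-off (≢F ∘ ≡.cong elements))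
        (restrict-in {F} {L} {G} g F<G G<L)
        (trans (reflexive (restrict-in {K} {L} {G} g K<G G<L)) (ooz (g G)))
      cases G (no ≢F) (yes K<G) (yes G<L) (no G≮F) (no F≮G) = add
        (restrict-out {K} {F} {G} g (G≮F ∘ proj₂)) (δ-off (≢F ∘ ≡.cong elements))
        (restrict-out {F} {L} {G} g (F≮G ∘ proj₁))
        (trans (trans (reflexive (restrict-in {K} {L} {G} g K<G G<L))
          (incomp G K<G G<L (λ G⊆F → ≢F (≡.cong elements (⊆-≡ {F = G} {F} G⊆F G≮F)))
                            (λ F⊆G → ≢F (≡.sym (≡.cong elements (⊆-≡ {F = F} {G} F⊆G F≮G))))))
          (ooz 0#))
      pointwise : ∀ G → restrict K L g G ≈ (restrict K F g G + δ G) + restrict F L g G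
      pointwise G = cases G (elements G ≟ elements F) (K <? G) (G <? L) (G <? F) (F <? G)

-- Algebras over ℝ: integer scalars, indicators and averages.

record ℝ-Algebra : Set₁ where
  field
    commutativeRing : CommutativeRing 0ℓ 0ℓ
  open CommutativeRing commutativeRing
  field
    ι      : ℝ → Carrier
    ι-cong : ∀ {a b} → a ≈ℝ b → ι a ≈ ι b
    ι-+    : ∀ a b → ι (a +ℝ b) ≈ ι a + ι b
    ι-*    : ∀ a b → ι (a *ℝ b) ≈ ι a * ι b
    ι-0    : ι 0ℝ ≈ 0#
    ι-1    : ι 1ℝ ≈ 1#

module Fractions (Q : ℝ-Algebra) where
  open ℝ-Algebra Q
  open CommutativeRing commutativeRing
  open ListSum commutativeRing
  open SetoidReasoning setoid
  open FinSum +-commutativeMonoid using (sum; sum-cong-≋; ∑-distrib-+)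

  -- Opaque, as otherwise unification problems κ a = κ b unfold to the normalisation of fractions.
  opaque
    κ : ℕ → Carrier
    κ k = ι (k ÷ 1)

    κ-def : ∀ k → κ k ≡ ι (k ÷ 1)
    κ-def k = ≡.refl

    κ-+ : ∀ a b → κ (a ℕ.+ b) ≈ κ a + κ b
    κ-+ a b = trans (reflexive (≡.cong (λ q → ι (fromℚ q)) (/1-+ a b)))
      (trans (ι-cong (fromℚ-+ (ℤ.+ a ℚ./ 1) (ℤ.+ b ℚ./ 1))) (ι-+ (a ÷ 1) (b ÷ 1)))

    ÷-* : ∀ a b l m → ι (a ÷ suc l) * ι ((b ℕ.* suc l) ÷ suc m) ≈ ι ((a ℕ.* b) ÷ suc m)
    ÷-* a b l m = trans (sym (ι-* (a ÷ suc l) ((b ℕ.* suc l) ÷ suc m)))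
      (trans (ι-cong (R.sym (fromℚ-* (ℤ.+ a ℚ./ suc l) _))) (reflexive (≡.cong (λ q → ι (fromℚ q)) (/-* a b l m))))
      where module R = CommutativeRing ℝ-commutativeRing

    κ-0 : κ 0 ≈ 0#
    κ-0 = ι-0

    κ-1 : κ 1 ≈ 1#
    κ-1 = ι-1

    κ-* : ∀ a b → κ (a ℕ.* b) ≈ κ a * κ b
    κ-* a b = sym (trans (*-congˡ (reflexive (≡.cong κ (≡.sym (ℕ.*-identityʳ b))))) (÷-* a b 0 0))

    ÷-κ : ∀ a m → ι (1 ÷ suc m) * κ (a ℕ.* suc m) ≈ κ a
    ÷-κ a m = trans (÷-* 1 a m 0) (reflexive (≡.cong κ (ℕ.*-identityˡ a)))

    ÷≈ : ∀ a m → ι (1 ÷ suc m) * κ a ≈ ι (a ÷ suc m)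
    ÷≈ a m = trans (*-comm _ _) (trans (*-congˡ (reflexive (≡.cong (λ k → ι (k ÷ suc m)) (≡.sym (ℕ.*-identityʳ 1)))))
      (trans (÷-* a 1 0 m) (reflexive (≡.cong (λ k → ι (k ÷ suc m)) (ℕ.*-identityʳ a)))))

    ÷-inverse : ∀ m → ι (1 ÷ suc m) * κ (suc m) ≈ 1#
    ÷-inverse m = trans (*-congˡ (reflexive (≡.cong κ (≡.sym (ℕ.*-identityˡ (suc m)))))) (trans (÷-κ 1 m) κ-1)

  κ-cancel : ∀ k .⦃ _ : ℕ.NonZero k ⦄ {x y} → κ k * x ≈ κ k * y → x ≈ y
  κ-cancel (suc m) {x} {y} eq = begin
    x                                    ≈⟨ *-identityˡ x ⟨
    1# * x                               ≈⟨ *-congʳ (÷-inverse m) ⟨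
    (ι (1 ÷ suc m) * κ (suc m)) * x      ≈⟨ *-assoc _ _ x ⟩
    ι (1 ÷ suc m) * (κ (suc m) * x)      ≈⟨ *-congˡ eq ⟩
    ι (1 ÷ suc m) * (κ (suc m) * y)      ≈⟨ *-assoc _ _ y ⟨
    (ι (1 ÷ suc m) * κ (suc m)) * y      ≈⟨ *-congʳ (÷-inverse m) ⟩
    1# * y                               ≈⟨ *-identityˡ y ⟩
    y                                    ∎

  χ : ∀ {n} → Subset n → Fin n → Carrier → Carrier
  χ S i c = if lookup S i then c else 0#

  χ-∈ : ∀ {n} {S : Subset n} {i} c → i ∈ S → χ S i c ≡ c
  χ-∈ c i∈S = ≡.cong (if_then c else 0#) (Vec.[]=⇒lookup i∈S)

  χ-∉ : ∀ {n} {S : Subset n} {i} c → i ∉ S → χ S i c ≡ 0#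
  χ-∉ {S = S} {i} c i∉S with lookup S i in eq
  ... | true  = contradiction (Vec.lookup⇒[]= i S eq) i∉S
  ... | false = ≡.refl

  χ-cong : ∀ {n} (S : Subset n) i {b c} → b ≈ c → χ S i b ≈ χ S i c
  χ-cong S i eq with lookup S i
  ... | true  = eq
  ... | false = refl

  χ-* : ∀ {n} (S : Subset n) i b c → χ S i b * c ≈ χ S i (b * c)
  χ-* S i b c with lookup S i
  ... | true  = refl
  ... | false = zeroˡ c

  χ-0 : ∀ {n} (S : Subset n) i {c} → c ≈ 0# → χ S i c ≈ 0#
  χ-0 S i eq with lookup S i
  ... | true  = eq
  ... | false = refl

  sum-χ : ∀ {n} (S : Subset n) c → sum (λ i → χ S i c) ≈ κ ∣ S ∣ * c
  sum-χ []            c = sym (trans (*-congʳ κ-0) (zeroˡ c))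
  sum-χ (outside ∷ S) c = trans (+-identityˡ _) (sum-χ S c)
  sum-χ (inside ∷ S)  c = begin
    c + sum (λ i → χ S i c)     ≈⟨ +-cong (sym (*-identityˡ c)) (sum-χ S c) ⟩
    1# * c + κ ∣ S ∣ * c        ≈⟨ distribʳ c 1# (κ ∣ S ∣) ⟨
    (1# + κ ∣ S ∣) * c          ≈⟨ *-congʳ (trans (κ-+ 1 ∣ S ∣) (+-congʳ κ-1)) ⟨
    κ (suc ∣ S ∣) * c           ∎

  sum-Σ : ∀ {A : Set} {n} (xs : List A) (f : Fin n → A → Carrier) →
          sum (λ i → Σ xs (f i)) ≈ Σ xs (λ a → sum (λ i → f i a))
  sum-Σ {n = n} []       f = sum-0 n
    where
    sum-0 : ∀ n → sum {n} (λ _ → 0#) ≈ 0#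
    sum-0 zero    = refl
    sum-0 (suc n) = trans (+-identityˡ _) (sum-0 n)
  sum-Σ (a ∷ xs) f = trans (∑-distrib-+ (λ i → f i a) (λ i → Σ xs (f i))) (+-congˡ (sum-Σ xs f))

  -- Double counting: when the hypothesis is summed over all elements of `S`, the value `y a` is
  -- counted once for each element of `P a`, and `c` once for each element of `S`. Division by the
  -- size of `S`, nonzero because of `i∈S`, produces the fractions that occur in `π`.
  average : ∀ {A : Set} {n} (xs : List A) (P : A → Subset n) (S : Subset n) (y : A → Carrier) c → ∀ {i} → i ∈ S →
            (∀ a → P a ⊆ S) → (∀ {i} → i ∈ S → Σ xs (λ a → χ (P a) i (y a)) ≈ c) →
            Σ xs (λ a → ι (∣ P a ∣ ÷ ∣ S ∣) * y a) ≈ c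
  average xs P S y c i∈S P⊆S h with m , size ← ∈⇒∣∣≡suc i∈S = begin
    Σ xs (λ a → ι (∣ P a ∣ ÷ ∣ S ∣) * y a)
      ≡⟨ ≡.cong (λ k → Σ xs (λ a → ι (∣ P a ∣ ÷ k) * y a)) size ⟩
    Σ xs (λ a → ι (∣ P a ∣ ÷ suc m) * y a)
      ≈⟨ Σ-cong xs (λ a → trans (*-congʳ (sym (÷≈ ∣ P a ∣ m))) (*-assoc _ _ (y a))) ⟩
    Σ xs (λ a → ι (1 ÷ suc m) * (κ ∣ P a ∣ * y a))
      ≈⟨ Σ-*ˡ xs (ι (1 ÷ suc m)) _ ⟩
    ι (1 ÷ suc m) * Σ xs (λ a → κ ∣ P a ∣ * y a)
      ≈⟨ *-congˡ (Σ-cong xs (λ a → sym (sum-χ (P a) (y a)))) ⟩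
    ι (1 ÷ suc m) * Σ xs (λ a → sum (λ i → χ (P a) i (y a)))
      ≈⟨ *-congˡ (sum-Σ xs (λ i a → χ (P a) i (y a))) ⟨
    ι (1 ÷ suc m) * sum (λ i → Σ xs (λ a → χ (P a) i (y a)))
      ≈⟨ *-congˡ (sum-cong-≋ at) ⟩
    ι (1 ÷ suc m) * sum (λ i → χ S i c)
      ≈⟨ *-congˡ (sum-χ S c) ⟩
    ι (1 ÷ suc m) * (κ ∣ S ∣ * c)
      ≈⟨ *-assoc (ι (1 ÷ suc m)) _ c ⟨
    (ι (1 ÷ suc m) * κ ∣ S ∣) * c
      ≈⟨ *-congʳ (trans (*-congˡ (reflexive (≡.cong κ size))) (÷-inverse m)) ⟩
    1# * c
      ≈⟨ *-identityˡ c ⟩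
    c ∎
    where
    at : ∀ i → Σ xs (λ a → χ (P a) i (y a)) ≈ χ S i c
    at i with lookup S i in eq
    ... | true  = h (Vec.lookup⇒[]= i S eq)
    ... | false = Σ-0 xs (λ a → reflexive (χ-∉ (y a) (λ i∈P → contradiction (≡.trans (≡.sym eq) (Vec.[]=⇒lookup (P⊆S a i∈P))) λ ())))

-- Powers of a sum of two nilpotent elements, and evaluation of polynomials.

module AlgebraProperties (Q : ℝ-Algebra) where
  open ℝ-Algebra Q public
  open CommutativeRing commutativeRing public
  open ListSum commutativeRing public
  open Fractions Q public
  open Exp semiring public using (_^_; ^-congʳ; ^-congˡ)
  open GroupProperties +-group public using (∙-cancelʳ; inverseʳ-unique; inverseˡ-unique)
  open RingProperties ring public using (-‿distribˡ-*; -‿distribʳ-*)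
  open SemiringSolver commutativeSemiring public using (solve; _:+_; _:*_; _:=_)
  open SetoidReasoning setoid

  Σ-*ʳ : ∀ {A : Set} (xs : List A) (f : A → Carrier) c → Σ xs f * c ≈ Σ xs (λ a → f a * c)
  Σ-*ʳ xs f c = trans (*-comm _ c) (trans (sym (Σ-*ˡ xs c f)) (Σ-cong xs (λ a → *-comm c (f a))))

  swap : ∀ a b c → a * (b * c) ≈ b * (a * c)
  swap = solve 3 (λ a b c → (a :* (b :* c)) := (b :* (a :* c))) refl

  slide : ∀ a c v → (a * c) * v ≈ c * (a * v)
  slide = solve 3 (λ a c v → ((a :* c) :* v) := (c :* (a :* v))) refl

  *0 : ∀ c {v} → v ≈ 0# → c * v ≈ 0#
  *0 c eq = trans (*-congˡ eq) (zeroʳ c)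

  -- Every term of degree p + q + 1 contains more than p factors `a` or more than q factors `b`. The
  -- binomial expansion is never written out: one factor at a time moves into `v`, which lowers the
  -- exponent in one of the two hypotheses.
  ^-vanish-+ : ∀ {a b v} p q → a ^ suc p * v ≈ 0# → b ^ suc q * v ≈ 0# → (a + b) ^ suc (p ℕ.+ q) * v ≈ 0#
  ^-vanish-+ˡ : ∀ {a b v} p q → a ^ suc p * v ≈ 0# → b ^ suc q * v ≈ 0# → (a + b) ^ (p ℕ.+ q) * (a * v) ≈ 0#
  ^-vanish-+ʳ : ∀ {a b v} p q → a ^ suc p * v ≈ 0# → b ^ suc q * v ≈ 0# → (a + b) ^ (p ℕ.+ q) * (b * v) ≈ 0#

  ^-+-step : ∀ a b v m → (a + b) ^ suc m * v ≈ (a + b) ^ m * (a * v) + (a + b) ^ m * (b * v)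
  ^-+-step a b v m = solve 4 (λ a b c v → (((a :+ b) :* c) :* v) := (c :* (a :* v) :+ c :* (b :* v))) refl a b ((a + b) ^ m) v

  ^-vanish-+ {a} {b} {v} p q av bv = trans (^-+-step a b v (p ℕ.+ q))
    (trans (+-cong (^-vanish-+ˡ p q av bv) (^-vanish-+ʳ p q av bv)) (+-identityˡ 0#))

  ^-vanish-+ˡ zero    q av bv = *0 _ (trans (*-congʳ (sym (*-identityʳ _))) av)
  ^-vanish-+ˡ {a} {b} {v} (suc p) q av bv = ^-vanish-+ p q
    (trans (sym (slide a (a ^ suc p) v)) av) (trans (swap (b ^ suc q) a v) (*0 a bv))

  ^-vanish-+ʳ {a} {b} {v} p zero    av bv = *0 _ (trans (*-congʳ (sym (*-identityʳ _))) bv)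
  ^-vanish-+ʳ {a} {b} {v} p (suc q) av bv = trans (*-congʳ (^-congʳ (a + b) (ℕ.+-suc p q))) (^-vanish-+ p q
    (trans (swap (a ^ suc p) b v) (*0 b av)) (trans (sym (slide b (b ^ suc q) v)) bv))

  ^-absorbˡ : ∀ {a b v} q → a * v ≈ 0# → (a + b) ^ q * v ≈ b ^ q * v
  ^-absorbˡ zero av = refl
  ^-absorbˡ {a} {b} {v} (suc q) av = begin
    (a + b) ^ suc q * v                              ≈⟨ ^-+-step a b v q ⟩
    (a + b) ^ q * (a * v) + (a + b) ^ q * (b * v)    ≈⟨ +-cong (*0 _ av) (^-absorbˡ q (trans (swap a b v) (*0 b av))) ⟩
    0# + b ^ q * (b * v)                             ≈⟨ +-identityˡ _ ⟩
    b ^ q * (b * v)                                  ≈⟨ slide b (b ^ q) v ⟨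
    b ^ suc q * v                                    ∎

  -- Only one term of the binomial expansion survives; both sides are cleared of denominators.
  ^-split : ∀ {a b v} p q → a ^ suc p * v ≈ 0# → b ^ suc q * v ≈ 0# →
            κ (p ! ℕ.* q !) * ((a + b) ^ (p ℕ.+ q) * v) ≈ κ ((p ℕ.+ q) !) * (a ^ p * (b ^ q * v))
  ^-split {a} {b} {v} zero q av bv = *-cong (reflexive (≡.cong κ (ℕ.*-identityˡ (q !))))
    (trans (^-absorbˡ q (trans (*-congʳ (sym (*-identityʳ a))) av)) (sym (*-identityˡ _)))
  ^-split {a} {b} {v} (suc p) zero av bv = *-cong
    (reflexive (≡.cong κ (≡.trans (ℕ.*-identityʳ (suc p !)) (≡.cong _! (≡.sym (ℕ.+-identityʳ (suc p)))))))
    (begin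
      (a + b) ^ (suc p ℕ.+ 0) * v   ≈⟨ *-congʳ (^-congʳ (a + b) (ℕ.+-identityʳ (suc p))) ⟩
      (a + b) ^ suc p * v           ≈⟨ *-congʳ (^-congˡ (suc p) (+-comm a b)) ⟩
      (b + a) ^ suc p * v           ≈⟨ ^-absorbˡ (suc p) (trans (*-congʳ (sym (*-identityʳ b))) bv) ⟩
      a ^ suc p * v                 ≈⟨ *-congˡ (*-identityˡ v) ⟨
      a ^ suc p * (1# * v)          ∎)
  ^-split {a} {b} {v} (suc p) (suc q) av bv = begin
    κ (suc p ! ℕ.* suc q !) * ((a + b) ^ suc (p ℕ.+ suc q) * v)
      ≈⟨ *-congˡ (^-+-step a b v (p ℕ.+ suc q)) ⟩
    κ (suc p ! ℕ.* suc q !) * ((a + b) ^ (p ℕ.+ suc q) * (a * v) + (a + b) ^ (p ℕ.+ suc q) * (b * v))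
      ≈⟨ distribˡ _ _ _ ⟩
    κ (suc p ! ℕ.* suc q !) * ((a + b) ^ (p ℕ.+ suc q) * (a * v)) + κ (suc p ! ℕ.* suc q !) * ((a + b) ^ (p ℕ.+ suc q) * (b * v))
      -- Pascal's rule with denominators cleared: the terms beginning with `a` and with `b`
      -- contribute `suc p` and `suc q` times `N * W`, and these coefficients add up to the next
      -- factor of the factorial.
      ≈⟨ +-cong left right ⟩
    κ (suc p) * (N * W) + κ (suc q) * (N * W)
      ≈⟨ solve 4 (λ x y n w → (x :* (n :* w) :+ y :* (n :* w)) := (((x :+ y) :* n) :* w)) refl _ _ N W ⟩
    ((κ (suc p) + κ (suc q)) * N) * W
      ≈⟨ *-congʳ (*-congʳ (sym (κ-+ (suc p) (suc q)))) ⟩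
    (κ (suc p ℕ.+ suc q) * N) * W
      ≈⟨ *-congʳ (sym (κ-* (suc p ℕ.+ suc q) ((p ℕ.+ suc q) !))) ⟩
    κ ((suc p ℕ.+ suc q) !) * W
      ∎
    where
    N = κ ((p ℕ.+ suc q) !)
    W = a ^ suc p * (b ^ suc q * v)
    left : κ (suc p ! ℕ.* suc q !) * ((a + b) ^ (p ℕ.+ suc q) * (a * v)) ≈ κ (suc p) * (N * W)
    left = begin
      κ (suc p ! ℕ.* suc q !) * ((a + b) ^ (p ℕ.+ suc q) * (a * v))
        ≈⟨ *-congʳ (trans (reflexive (≡.cong κ (ℕ.*-assoc (suc p) (p !) (suc q !)))) (κ-* (suc p) _)) ⟩
      (κ (suc p) * κ (p ! ℕ.* suc q !)) * ((a + b) ^ (p ℕ.+ suc q) * (a * v))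
        ≈⟨ *-assoc _ _ _ ⟩
      κ (suc p) * (κ (p ! ℕ.* suc q !) * ((a + b) ^ (p ℕ.+ suc q) * (a * v)))
        ≈⟨ *-congˡ (^-split p (suc q) (trans (sym (slide a (a ^ suc p) v)) av) (trans (swap (b ^ suc (suc q)) a v) (*0 a bv))) ⟩
      κ (suc p) * (N * (a ^ p * (b ^ suc q * (a * v))))
        ≈⟨ *-congˡ (*-congˡ (solve 4 (λ a c d v → (c :* (d :* (a :* v))) := ((a :* c) :* (d :* v))) refl a (a ^ p) (b ^ suc q) v)) ⟩
      κ (suc p) * (N * W)
        ∎
    right : κ (suc p ! ℕ.* suc q !) * ((a + b) ^ (p ℕ.+ suc q) * (b * v)) ≈ κ (suc q) * (N * W)
    right = begin
      κ (suc p ! ℕ.* suc q !) * ((a + b) ^ (p ℕ.+ suc q) * (b * v))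
        ≈⟨ *-cong (trans (reflexive (≡.cong κ (≡.trans (ℕ.*-comm (suc p !) (suc q !)) (≡.trans (ℕ.*-assoc (suc q) (q !) (suc p !)) (≡.cong (suc q ℕ.*_) (ℕ.*-comm (q !) (suc p !))))))) (κ-* (suc q) _))
                  (*-congʳ (^-congʳ (a + b) (ℕ.+-suc p q))) ⟩
      (κ (suc q) * κ (suc p ! ℕ.* q !)) * ((a + b) ^ (suc p ℕ.+ q) * (b * v))
        ≈⟨ *-assoc _ _ _ ⟩
      κ (suc q) * (κ (suc p ! ℕ.* q !) * ((a + b) ^ (suc p ℕ.+ q) * (b * v)))
        ≈⟨ *-congˡ (^-split (suc p) q (trans (swap (a ^ suc (suc p)) b v) (*0 b av)) (trans (sym (slide b (b ^ suc q) v)) bv)) ⟩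
      κ (suc q) * (κ ((suc p ℕ.+ q) !) * (a ^ suc p * (b ^ q * (b * v))))
        ≈⟨ *-congˡ (*-cong (reflexive (≡.cong (λ k → κ (k !)) (≡.sym (ℕ.+-suc p q)))) (*-congˡ (sym (slide b (b ^ q) v)))) ⟩
      κ (suc q) * (N * W)
        ∎

  ev : ∀ {V} → (V → Carrier) → ℝ[ V ] → Carrier
  ev σ (con a) = ι a
  ev σ (var v) = σ v
  ev σ (p ⊕ q) = ev σ p + ev σ q
  ev σ (p ⊗ q) = ev σ p * ev σ q
  ev σ (⊖ p)   = - ev σ p

  ev-substitute : ∀ {V W} (σ : W → Carrier) (τ : V → ℝ[ W ]) p → ev σ (substitute τ p) ≡ ev (ev σ ∘ τ) p
  ev-substitute σ τ (con a) = ≡.refl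
  ev-substitute σ τ (var v) = ≡.refl
  ev-substitute σ τ (p ⊕ q) = ≡.cong₂ _+_ (ev-substitute σ τ p) (ev-substitute σ τ q)
  ev-substitute σ τ (p ⊗ q) = ≡.cong₂ _*_ (ev-substitute σ τ p) (ev-substitute σ τ q)
  ev-substitute σ τ (⊖ p)   = ≡.cong (-_) (ev-substitute σ τ p)

  ev-∑ : ∀ {A V : Set} (σ : V → Carrier) (xs : List A) f → ev σ (∑ (List.map f xs)) ≈ Σ xs (λ a → ev σ (f a))
  ev-∑ σ []       f = ι-0
  ev-∑ σ (a ∷ xs) f = +-congˡ (ev-∑ σ xs f)

-- Passage of the Chow relations to the intervals below and above a flat.

module Intervals (Q : ℝ-Algebra) {n : ℕ} {M : Matroid n} (x : Flat M → CommutativeRing.Carrier (ℝ-Algebra.commutativeRing Q)) where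
  open AlgebraProperties Q
  open SetoidReasoning setoid

  -- The relations of the Chow ring of [K , L], holding after multiplication by u.
  record ChowRelations (K L : Flat M) (u : Carrier) : Set where
    field
      incomp : ∀ {F G} → K < F → F < L → K < G → G < L →
                     elements F ⊈ elements G → elements G ⊈ elements F → x F * (x G * u) ≈ 0#
      balanced : ∀ {i j} → i ∈ elements L ─ elements K → j ∈ elements L ─ elements K →
               Σ (between K L) (λ G → χ (elements ⌊ G ⌋) i (x ⌊ G ⌋ * u)) ≈
               Σ (between K L) (λ G → χ (elements ⌊ G ⌋) j (x ⌊ G ⌋ * u))
  open ChowRelations

  ChowRelations-* : ∀ {K L u} v → ChowRelations K L u → ChowRelations K L (v * u)
  ChowRelations-* {u = u} v r .incomp {F} {G} p q p′ q′ F⊈G G⊈F = trans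
    (solve 4 (λ a b c d → (a :* (b :* (c :* d))) := (c :* (a :* (b :* d)))) refl (x F) (x G) v u)
    (*0 v (r .incomp p q p′ q′ F⊈G G⊈F))
  ChowRelations-* {K} {L} {u} v r .balanced i∈ j∈ = trans (pull _) (trans (*-congˡ (r .balanced i∈ j∈)) (sym (pull _)))
    where
    pull : ∀ i → Σ (between K L) (λ G → χ (elements ⌊ G ⌋) i (x ⌊ G ⌋ * (v * u))) ≈
                 v * Σ (between K L) (λ G → χ (elements ⌊ G ⌋) i (x ⌊ G ⌋ * u))
    pull i = trans (Σ-cong (between K L) (λ G → trans (χ-cong (elements ⌊ G ⌋) i (trans (swap (x ⌊ G ⌋) v u) (*-comm v _)))
        (trans (sym (χ-* (elements ⌊ G ⌋) i _ v)) (*-comm _ v)))) (Σ-*ˡ (between K L) v _)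

  module _ {K F L : Flat M} (K<F : K < F) (F<L : F < L) {u : Carrier} (r : ChowRelations K L u) where
    private
      K<L : K < L
      K<L = <-trans {F = K} {F} {L} K<F F<L
      v : Carrier
      v = x F * u
      Y : Flat M → Carrier
      Y G = x G * v

      r′ : ChowRelations K L v
      r′ = ChowRelations-* (x F) r

      Y-incomp : ∀ {G} → K < G → G < L → elements G ⊈ elements F → elements F ⊈ elements G → Y G ≈ 0#
      Y-incomp {G} K<G G<L G⊈F F⊈G = r .incomp {G} {F} K<G G<L K<F F<L G⊈F F⊈G

      at : Fin n → Flat M → Carrier
      at i G = χ (elements G) i (Y G)

      split : ∀ i → Σ (between K L) (at i ∘ ⌊_⌋) ≈ (Σ (between K F) (at i ∘ ⌊_⌋) + at i F) + Σ (between F L) (at i ∘ ⌊_⌋)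
      split i = Σ-split K F L (at i) K<F F<L λ G K<G G<L G⊈F F⊈G → χ-0 (elements G) i (Y-incomp {G} K<G G<L G⊈F F⊈G)

      U : Carrier
      U = Σ (between F L) (Y ∘ ⌊_⌋)

      -- A flat above `F` contains every element of `F`, so the part of the sum from `F` upwards is
      -- the same for all such `i`.
      split-F : ∀ {i} → i ∈ elements F → Σ (between K L) (at i ∘ ⌊_⌋) ≈ Σ (between K F) (at i ∘ ⌊_⌋) + (Y F + U)
      split-F {i} i∈F = trans (split i) (trans (+-assoc _ _ _) (+-congˡ (+-cong (reflexive (χ-∈ (Y F) i∈F))
        (Σ-cong (between F L) λ G → reflexive (χ-∈ (Y ⌊ G ⌋) (proj₁ (lower< G) i∈F))))))

      split-∉F : ∀ {i} → i ∉ elements F → Σ (between K L) (at i ∘ ⌊_⌋) ≈ Σ (between F L) (at i ∘ ⌊_⌋)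
      split-∉F {i} i∉F = trans (split i) (trans (+-congʳ (trans (+-cong
        (Σ-0 (between K F) λ G → reflexive (χ-∉ (Y ⌊ G ⌋) (i∉F ∘ proj₁ (upper< G))))
        (reflexive (χ-∉ (Y F) i∉F))) (+-identityˡ 0#))) (+-identityˡ _))

      F─K⊆L─K : ∀ {i} → i ∈ elements F ─ elements K → i ∈ elements L ─ elements K
      F─K⊆L─K i∈ = x∈p∧x∉q⇒x∈p─q (proj₁ F<L (p─q⊆p (elements F) (elements K) i∈)) (∈─⇒∉ (elements F) (elements K) i∈)

      L─F⊆L─K : ∀ {i} → i ∈ elements L ─ elements F → i ∈ elements L ─ elements K
      L─F⊆L─K i∈ = x∈p∧x∉q⇒x∈p─q (p─q⊆p (elements L) (elements F) i∈) (∈─⇒∉ (elements L) (elements F) i∈ ∘ proj₁ K<F)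

    -- By `split-F` the relation of [K , L] contains the summand `Y F + U` on both sides, and it
    -- cancels.
    ChowRelations-lower : ChowRelations K F v
    ChowRelations-lower .incomp {G} {H} p q p′ q′ = r′ .incomp {G} {H} p (<-trans {F = G} {F} {L} q F<L) p′ (<-trans {F = H} {F} {L} q′ F<L)
    ChowRelations-lower .balanced {i} {j} i∈ j∈ = ∙-cancelʳ (Y F + U) _ _ (begin
      Σ (between K F) (at i ∘ ⌊_⌋) + (Y F + U)  ≈⟨ split-F (p─q⊆p (elements F) (elements K) i∈) ⟨
      Σ (between K L) (at i ∘ ⌊_⌋)              ≈⟨ r′ .balanced (F─K⊆L─K i∈) (F─K⊆L─K j∈) ⟩
      Σ (between K L) (at j ∘ ⌊_⌋)              ≈⟨ split-F (p─q⊆p (elements F) (elements K) j∈) ⟩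
      Σ (between K F) (at j ∘ ⌊_⌋) + (Y F + U)  ∎)

    -- For elements outside `F` only flats above `F` contribute, so the relation of [K , L] after
    -- multiplication by `x F` is already that of [F , L].
    ChowRelations-upper : ChowRelations F L v
    ChowRelations-upper .incomp {G} {H} p q p′ q′ = r′ .incomp {G} {H} (<-trans {F = K} {F} {G} K<F p) q (<-trans {F = K} {F} {H} K<F p′) q′
    ChowRelations-upper .balanced {i} {j} i∈ j∈ = begin
      Σ (between F L) (at i ∘ ⌊_⌋)              ≈⟨ split-∉F (∈─⇒∉ (elements L) (elements F) i∈) ⟨
      Σ (between K L) (at i ∘ ⌊_⌋)              ≈⟨ r′ .balanced (L─F⊆L─K i∈) (L─F⊆L─K j∈) ⟩
      Σ (between K L) (at j ∘ ⌊_⌋)              ≈⟨ split-∉F (∈─⇒∉ (elements L) (elements F) j∈) ⟩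
      Σ (between F L) (at j ∘ ⌊_⌋)              ∎

    private
      -- The weights are the coefficients with which t_F is subtracted in π_K^F and in π_F^L.
      lowerMean upperMean : Carrier
      lowerMean = Σ (between K F) (λ G → ι (∣ elements ⌊ G ⌋ ─ elements K ∣ ÷ ∣ elements F ─ elements K ∣) * Y ⌊ G ⌋)
      upperMean = Σ (between F L) (λ G → ι (∣ elements L ─ elements ⌊ G ⌋ ∣ ÷ ∣ elements L ─ elements F ∣) * Y ⌊ G ⌋)

      -- Written with the set differences whose sizes are the weights of the means, as `average`
      -- requires. For `i` outside `K` the first is the sum over the flats containing `i`; the
      -- second is, for `j` in `L`, the sum over the flats that miss `j`.
      below above : Fin n → Carrier
      below i = Σ (between K F) (λ G → χ (elements ⌊ G ⌋ ─ elements K) i (Y ⌊ G ⌋))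
      above j = Σ (between F L) (λ G → χ (elements L ─ elements ⌊ G ⌋) j (Y ⌊ G ⌋))

      χ-⇔ : ∀ {S T : Subset n} {i} c → (i ∈ S → i ∈ T) → (i ∈ T → i ∈ S) → χ S i c ≡ χ T i c
      χ-⇔ {S} {T} {i} c f g with i ∈? S
      ... | yes i∈S = ≡.trans (χ-∈ c i∈S) (≡.sym (χ-∈ c (f i∈S)))
      ... | no  i∉S = ≡.trans (χ-∉ c i∉S) (≡.sym (χ-∉ c (i∉S ∘ g)))

      χ-+-∁ : ∀ (G : Between F L) {j} → j ∈ elements L → at j ⌊ G ⌋ + χ (elements L ─ elements ⌊ G ⌋) j (Y ⌊ G ⌋) ≈ Y ⌊ G ⌋
      χ-+-∁ G {j} j∈L with j ∈? elements ⌊ G ⌋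
      ... | yes j∈G = trans (+-cong (reflexive (χ-∈ (Y ⌊ G ⌋) j∈G)) (reflexive (χ-∉ (Y ⌊ G ⌋) (λ j∈ → ∈─⇒∉ (elements L) _ j∈ j∈G)))) (+-identityʳ _)
      ... | no  j∉G = trans (+-cong (reflexive (χ-∉ (Y ⌊ G ⌋) j∉G)) (reflexive (χ-∈ (Y ⌊ G ⌋) (x∈p∧x∉q⇒x∈p─q j∈L j∉G)))) (+-identityˡ _)

      -- The linear relation for i and j after multiplication by x F, with the terms above F containing j cancelled.
      balance : ∀ {i j} → i ∈ elements F ─ elements K → j ∈ elements L ─ elements F → below i + (Y F + above j) ≈ 0#
      balance {i} {j} i∈ j∈ = ∙-cancelʳ (Σ (between F L) (at j ∘ ⌊_⌋)) _ _ (begin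
        (below i + (Y F + above j)) + Σ (between F L) (at j ∘ ⌊_⌋)
          ≈⟨ solve 4 (λ a b c d → ((a :+ (b :+ c)) :+ d) := (a :+ (b :+ (d :+ c)))) refl (below i) (Y F) (above j) _ ⟩
        below i + (Y F + (Σ (between F L) (at j ∘ ⌊_⌋) + above j))
          ≈⟨ +-cong (Σ-cong (between K F) λ G → reflexive (χ-⇔ (Y ⌊ G ⌋) (p─q⊆p (elements ⌊ G ⌋) (elements K))
               (λ i∈G → x∈p∧x∉q⇒x∈p─q i∈G (∈─⇒∉ (elements F) (elements K) i∈))))
               (+-congˡ (trans (sym (Σ-+ (between F L) _ _)) (Σ-cong (between F L) λ G → χ-+-∁ G (p─q⊆p (elements L) (elements F) j∈)))) ⟩
        Σ (between K F) (at i ∘ ⌊_⌋) + (Y F + U)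
          ≈⟨ split-F (p─q⊆p (elements F) (elements K) i∈) ⟨
        Σ (between K L) (at i ∘ ⌊_⌋)
          ≈⟨ r′ .balanced (F─K⊆L─K i∈) (L─F⊆L─K j∈) ⟩
        Σ (between K L) (at j ∘ ⌊_⌋)
          ≈⟨ split-∉F (∈─⇒∉ (elements L) (elements F) j∈) ⟩
        Σ (between F L) (at j ∘ ⌊_⌋)
          ≈⟨ +-identityˡ _ ⟨
        0# + Σ (between F L) (at j ∘ ⌊_⌋)
          ∎)

      -- Y F is x F * (x F * u).
      square : Y F ≈ - (lowerMean + upperMean)
      square = inverseʳ-unique _ _ (begin
          (lowerMean + upperMean) + Y F      ≈⟨ solve 3 (λ a b c → ((a :+ b) :+ c) := (b :+ (a :+ c))) refl _ _ _ ⟩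
          upperMean + (lowerMean + Y F)      ≈⟨ +-congʳ mean₂ ⟩
          - (lowerMean + Y F) + (lowerMean + Y F) ≈⟨ -‿inverseˡ _ ⟩
          0#                                 ∎)
        where
        i∈F─K : proj₁ (proj₂ K<F) ∈ elements F ─ elements K
        i∈F─K = x∈p∧x∉q⇒x∈p─q (proj₁ (proj₂ (proj₂ K<F))) (proj₂ (proj₂ (proj₂ K<F)))
        j∈L─F : proj₁ (proj₂ F<L) ∈ elements L ─ elements F
        j∈L─F = x∈p∧x∉q⇒x∈p─q (proj₁ (proj₂ (proj₂ F<L))) (proj₂ (proj₂ (proj₂ F<L)))
        -- First `j` is fixed and the average over `i` taken, `above j` being constant; then `mean₂`
        -- averages over `j`, with `lowerMean` as the constant.
        mean₁ : ∀ {j} → j ∈ elements L ─ elements F → lowerMean ≈ - (Y F + above j)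
        mean₁ j∈ = average (between K F) (λ G → elements ⌊ G ⌋ ─ elements K) (elements F ─ elements K) (Y ∘ ⌊_⌋) _
          i∈F─K
          (λ G {i} i∈ → x∈p∧x∉q⇒x∈p─q (proj₁ (upper< G) (p─q⊆p (elements ⌊ G ⌋) (elements K) i∈)) (∈─⇒∉ (elements ⌊ G ⌋) (elements K) i∈))
          (λ i∈ → inverseˡ-unique _ _ (balance i∈ j∈))
        mean₂ : upperMean ≈ - (lowerMean + Y F)
        mean₂ = average (between F L) (λ G → elements L ─ elements ⌊ G ⌋) (elements L ─ elements F) (Y ∘ ⌊_⌋) _
          j∈L─F
          (λ G {j} j∈ → x∈p∧x∉q⇒x∈p─q (p─q⊆p (elements L) (elements ⌊ G ⌋) j∈) (∈─⇒∉ (elements L) (elements ⌊ G ⌋) j∈ ∘ proj₁ (lower< G)))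
          (λ {j} j∈ → inverseʳ-unique _ _ (begin
            (lowerMean + Y F) + above j      ≈⟨ +-assoc _ _ _ ⟩
            lowerMean + (Y F + above j)      ≈⟨ +-congʳ (mean₁ j∈) ⟩
            - (Y F + above j) + (Y F + above j) ≈⟨ -‿inverseˡ _ ⟩
            0#                               ∎))

    module _ (s : Between K L → Carrier) where

      extended : Flat M → Carrier
      extended G = ev s (t K L G)

      private
        end-0 : ∀ {G} → ¬ (K < G × G < L) → extended G ≈ 0#
        end-0 {G} ¬p = trans (reflexive (≡.cong (λ m → ev s (maybe′ var (con 0ℝ) m)) (between?-nothing {K = K} {L} {G} ¬p))) ι-0

        f = extended F

        extended-in : ∀ (G : Between K L) → extended ⌊ G ⌋ ≡ s G
        extended-in G = ≡.cong (λ m → ev s (maybe′ var (con 0ℝ) m)) (between?-≡ G)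

        -- `z` is the coordinate at the end shared with [K , L], that is t_K or t_L. Being zero, it
        -- leaves the multiple of `f`, the coordinate at `F`, as the only correction made by `π`.
        expand : ∀ a α {z} β y → z ≈ 0# → ((a + - (f * α)) + - (z * β)) * y ≈ a * y + - f * (α * y)
        expand a α {z} β y z≈0 = begin
          ((a + - (f * α)) + - (z * β)) * y
            ≈⟨ *-congʳ (+-cong (+-congˡ (-‿distribˡ-* f α)) (trans (-‿distribˡ-* z β) (*-congʳ (trans (-‿cong z≈0) -0≈0)))) ⟩
          ((a + - f * α) + 0# * β) * y
            ≈⟨ *-congʳ (trans (+-congˡ (zeroˡ β)) (+-identityʳ _)) ⟩
          (a + - f * α) * y
            ≈⟨ solve 4 (λ a g α y → ((a :+ g :* α) :* y) := (a :* y :+ g :* (α :* y))) refl a (- f) α y ⟩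
          a * y + - f * (α * y)
            ∎
          where
          -0≈0 : - 0# ≈ 0#
          -0≈0 = sym (inverseˡ-unique 0# 0# (+-identityˡ 0#)) 

        expand′ : ∀ a α {z} β y → z ≈ 0# → ((a + - (z * β)) + - (f * α)) * y ≈ a * y + - f * (α * y)
        expand′ a α {z} β y z≈0 = trans (*-congʳ (solve 3 (λ a b c → ((a :+ b) :+ c) := ((a :+ c) :+ b)) refl a _ _)) (expand a α β y z≈0)

      lin-split : Σ (between K L) (λ G → s G * x ⌊ G ⌋) * v ≈
                  (Σ (between K F) (λ G → ev s (π K F (t K L) G) * x ⌊ G ⌋) +
                   Σ (between F L) (λ G → ev s (π F L (t K L) G) * x ⌊ G ⌋)) * v
      lin-split = begin
        Σ (between K L) (λ G → s G * x ⌊ G ⌋) * v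
          ≈⟨ Σ-*ʳ (between K L) _ v ⟩
        Σ (between K L) (λ G → (s G * x ⌊ G ⌋) * v)
          ≈⟨ Σ-cong (between K L) (λ G → trans (*-assoc _ _ v) (*-congʳ (reflexive (≡.sym (extended-in G))))) ⟩
        Σ (between K L) (g ∘ ⌊_⌋)
          ≈⟨ Σ-split K F L g K<F F<L (λ G K<G G<L G⊈F F⊈G → *0 (extended G) (Y-incomp {G} K<G G<L G⊈F F⊈G)) ⟩
        (A₁ + f * Y F) + A₂
          -- The term at `F` is traded for the two means, which are exactly the corrections turning
          -- the coordinates t_G into those of π_K^F and π_F^L.
          ≈⟨ +-congʳ (+-congˡ (trans (*-congˡ square) (trans (sym (-‿distribʳ-* f _)) (-‿distribˡ-* f _)))) ⟩
        (A₁ + - f * (lowerMean + upperMean)) + A₂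
          ≈⟨ solve 5 (λ a g m l b → ((a :+ g :* (m :+ l)) :+ b) := ((a :+ g :* m) :+ (b :+ g :* l))) refl A₁ (- f) lowerMean upperMean A₂ ⟩
        (A₁ + - f * lowerMean) + (A₂ + - f * upperMean)
          ≈⟨ +-cong lower-sum upper-sum ⟨
        S₁ * v + S₂ * v
          ≈⟨ distribʳ v S₁ S₂ ⟨
        (S₁ + S₂) * v
          ∎
        where
        g : Flat M → Carrier
        g G = extended G * Y G
        A₁ = Σ (between K F) (g ∘ ⌊_⌋)
        A₂ = Σ (between F L) (g ∘ ⌊_⌋)
        S₁ = Σ (between K F) (λ G → ev s (π K F (t K L) G) * x ⌊ G ⌋)
        S₂ = Σ (between F L) (λ G → ev s (π F L (t K L) G) * x ⌊ G ⌋)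
        lower-sum : S₁ * v ≈ A₁ + - f * lowerMean
        lower-sum = begin
          S₁ * v
            ≈⟨ Σ-*ʳ (between K F) _ v ⟩
          Σ (between K F) (λ G → (ev s (π K F (t K L) G) * x ⌊ G ⌋) * v)
            ≈⟨ Σ-cong (between K F) (λ G → trans (*-assoc _ _ v) (expand (extended ⌊ G ⌋) _ _ (Y ⌊ G ⌋) (end-0 {K} (λ p → <-irrefl {F = K} (proj₁ p))))) ⟩
          Σ (between K F) (λ G → g ⌊ G ⌋ + - f * (ι (∣ elements ⌊ G ⌋ ─ elements K ∣ ÷ ∣ elements F ─ elements K ∣) * Y ⌊ G ⌋))
            ≈⟨ trans (Σ-+ (between K F) _ _) (+-congˡ (Σ-*ˡ (between K F) (- f) _)) ⟩
          A₁ + - f * lowerMean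
            ∎
        upper-sum : S₂ * v ≈ A₂ + - f * upperMean
        upper-sum = begin
          S₂ * v
            ≈⟨ Σ-*ʳ (between F L) _ v ⟩
          Σ (between F L) (λ G → (ev s (π F L (t K L) G) * x ⌊ G ⌋) * v)
            ≈⟨ Σ-cong (between F L) (λ G → trans (*-assoc _ _ v) (expand′ (extended ⌊ G ⌋) _ _ (Y ⌊ G ⌋) (end-0 {L} (λ p → <-irrefl {F = L} (proj₂ p))))) ⟩
          Σ (between F L) (λ G → g ⌊ G ⌋ + - f * (ι (∣ elements L ─ elements ⌊ G ⌋ ∣ ÷ ∣ elements L ─ elements F ∣) * Y ⌊ G ⌋))
            ≈⟨ trans (Σ-+ (between F L) _ _) (+-congˡ (Σ-*ˡ (between F L) (- f) _)) ⟩
          A₂ + - f * upperMean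
            ∎

-- The recursion for powers of the linear form.

module _ {n : ℕ} {M : Matroid n} (p : (K L : Flat M) → ℝ[ Between K L ]) (K L : Flat M) where

  polSum : ℕ → ℝ[ Between K L ]
  polSum m = con (1 ÷ suc m) ⊗ ∑ (List.map (λ F → var F ⊗ substitute (π K ⌊ F ⌋ (t K L)) (p K ⌊ F ⌋)
                                                           ⊗ substitute (π ⌊ F ⌋ L (t K L)) (p ⌊ F ⌋ L)) (between K L))

  -- Abstracting over d K L in an equation between polStep and polSum is ill-typed; in this view it is not.
  data PolStep : ℕ → ℝ[ Between K L ] → Set where
    zero : PolStep 0 (con 1ℝ)
    suc  : ∀ m → PolStep (suc m) (polSum m)

  polStep-view : PolStep (d K L) (polStep p K L)
  polStep-view with d K L
  ... | zero  = zero
  ... | suc m = suc m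

  PolStep-0 : ∀ {e r} → PolStep e r → e ≡ 0 → r ≡ con 1ℝ
  PolStep-0 zero eq = ≡.refl

  PolStep-suc : ∀ {e r m} → PolStep e r → e ≡ suc m → r ≡ polSum m
  PolStep-suc (suc m) ≡.refl = ≡.refl

module Volume (Q : ℝ-Algebra) {n : ℕ} {M : Matroid n} (x : Flat M → CommutativeRing.Carrier (ℝ-Algebra.commutativeRing Q)) where
  open AlgebraProperties Q
  open Intervals Q x
  open SetoidReasoning setoid

  form : (K L : Flat M) → (Between K L → Carrier) → Carrier
  form K L s = Σ (between K L) (λ G → s G * x ⌊ G ⌋)

  -- The factor `x F` is not consumed by `lin-split`, so a single one serves for all `m`
  -- replacements.
  form-^ : ∀ {K L : Flat M} (F : Between K L) {u} → ChowRelations K L u → ∀ s m →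
           form K L s ^ m * (x ⌊ F ⌋ * u) ≈
           (form K ⌊ F ⌋ (ev s ∘ π K ⌊ F ⌋ (t K L)) + form ⌊ F ⌋ L (ev s ∘ π ⌊ F ⌋ L (t K L))) ^ m * (x ⌊ F ⌋ * u)
  form-^ F r s zero = refl
  form-^ {K} {L} F {u} r s (suc m) = begin
    (ℓ * ℓ ^ m) * v                ≈⟨ *-assoc _ _ v ⟩
    ℓ * (ℓ ^ m * v)                ≈⟨ *-congˡ (form-^ F r s m) ⟩
    ℓ * (ab ^ m * v)               ≈⟨ solve 3 (λ l c v → (l :* (c :* v)) := (c :* (l :* v))) refl ℓ (ab ^ m) v ⟩
    ab ^ m * (ℓ * v)               ≈⟨ *-congˡ (lin-split (lower< F) (upper< F) r s) ⟩
    ab ^ m * (ab * v)              ≈⟨ solve 3 (λ l c v → (c :* (l :* v)) := ((l :* c) :* v)) refl ab (ab ^ m) v ⟩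
    (ab * ab ^ m) * v              ∎
    where
    ℓ = form K L s
    v = x ⌊ F ⌋ * u
    ab = form K ⌊ F ⌋ (ev s ∘ π K ⌊ F ⌋ (t K L)) + form ⌊ F ⌋ L (ev s ∘ π ⌊ F ⌋ L (t K L))

  -- Only one of the factors is expanded; its sum becomes the sum over `F` in the recursion for
  -- `pol`.
  form-suc : ∀ (K L : Flat M) s m u → form K L s ^ suc m * u ≈
             Σ (between K L) (λ F → s F * (form K L s ^ m * (x ⌊ F ⌋ * u)))
  form-suc K L s m u = begin
    (form K L s * form K L s ^ m) * u
      ≈⟨ *-assoc _ _ u ⟩
    form K L s * (form K L s ^ m * u)
      ≈⟨ Σ-*ʳ (between K L) _ _ ⟩
    Σ (between K L) (λ F → (s F * x ⌊ F ⌋) * (form K L s ^ m * u))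
      ≈⟨ Σ-cong (between K L) (λ F → solve 4 (λ s x l u → ((s :* x) :* (l :* u)) := (s :* (l :* (x :* u)))) refl (s F) (x ⌊ F ⌋) _ u) ⟩
    Σ (between K L) (λ F → s F * (form K L s ^ m * (x ⌊ F ⌋ * u)))
      ∎

  private
    fuel-lower : ∀ {k} {K L : Flat M} (F : Between K L) → rkF L ℕ.≤ suc k ℕ.+ rkF K → rkF ⌊ F ⌋ ℕ.≤ k ℕ.+ rkF K
    fuel-lower {L = L} F h = ℕ.s≤s⁻¹ (ℕ.≤-trans (<⇒rk< {F = ⌊ F ⌋} {L} (upper< F)) h)

    fuel-upper : ∀ {k} {K L : Flat M} (F : Between K L) → rkF L ℕ.≤ suc k ℕ.+ rkF K → rkF L ℕ.≤ k ℕ.+ rkF ⌊ F ⌋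
    fuel-upper {k} {K} {L} F h = ℕ.≤-trans h
      (≡.subst (ℕ._≤ k ℕ.+ rkF ⌊ F ⌋) (ℕ.+-suc k (rkF K)) (ℕ.+-monoʳ-≤ k (<⇒rk< {F = K} {⌊ F ⌋} (lower< F))))

    -- Vanishing above the top degree, deduced from the relations alone. Once one factor is
    -- expanded, the `d K L` remaining ones are one more than the degrees of the lower and upper
    -- intervals together. If `L` covers `K`, the sum is empty.
    vanish : ∀ k {K L : Flat M} → rkF L ℕ.≤ k ℕ.+ rkF K → K < L → ∀ {u} → ChowRelations K L u → ∀ s → form K L s ^ suc (d K L) * u ≈ 0#
    vanish zero    {K} {L} h K<L r s = contradiction (<⇒rk< {F = K} {L} K<L) (ℕ.≤⇒≯ h)
    vanish (suc k) {K} {L} h K<L {u} r s = trans (form-suc K L s (d K L) u) (Σ-0 (between K L) λ F →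
      trans (*-congˡ (trans (form-^ F r s (d K L)) (trans (*-congʳ (^-congʳ _ (d-split {F = ⌊ F ⌋} (lower< F) (upper< F))))
        (^-vanish-+ (d K ⌊ F ⌋) (d ⌊ F ⌋ L)
          (vanish k (fuel-lower F h) (lower< F) (ChowRelations-lower (lower< F) (upper< F) r) _)
          (vanish k (fuel-upper F h) (upper< F) (ChowRelations-upper (lower< F) (upper< F) r) _)))))
        (zeroʳ (s F)))

  form-vanish : ∀ {K L : Flat M} → K < L → ∀ {u} → ChowRelations K L u → ∀ s → form K L s ^ suc (d K L) * u ≈ 0#
  form-vanish {K} {L} = vanish (rkF L) (ℕ.m≤m+n (rkF L) (rkF K))

  prod : List (Flat M) → Carrier
  prod = List.foldr (λ F c → x F * c) 1#

  prod-++ : ∀ Fs Gs → prod (Fs ++ Gs) ≈ prod Fs * prod Gs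
  prod-++ []       Gs = sym (*-identityˡ _)
  prod-++ (F ∷ Fs) Gs = trans (*-congˡ (prod-++ Fs Gs)) (sym (*-assoc _ _ _))

  -- All maximal flags have the same product with u, namely e, the class of a point.
  PointClass : Flat M → Flat M → Carrier → Carrier → Set
  PointClass K L u e = ∀ Fs → MaximalChain K Fs L → prod Fs * u ≈ e

  private
    -- The generality in `u` and `e` lets the induction be nested. The hypothesis for [K , F] is
    -- applied with multiplier b^q x_F u; that its maximal flags all have the same product with this
    -- multiplier is the hypothesis for [F , L], with such a flag included in the multiplier.
    volume : ∀ k {K L : Flat M} → rkF L ℕ.≤ k ℕ.+ rkF K → K < L → ∀ {u e} → ChowRelations K L u → PointClass K L u e →
             ∀ s → form K L s ^ d K L * u ≈ κ (d K L !) * (ev s (pol K L) * e)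
    volume zero    {K} {L} h K<L r c s = contradiction (<⇒rk< {F = K} {L} K<L) (ℕ.≤⇒≯ h)
    volume (suc k) {K} {L} h K<L {u} {e} r c s = cases (d K L) ≡.refl
      where
      ℓ = form K L s
      Pˡ Pᵘ : Between K L → Carrier
      Pˡ F = ev (ev s ∘ π K ⌊ F ⌋ (t K L)) (pol K ⌊ F ⌋)
      Pᵘ F = ev (ev s ∘ π ⌊ F ⌋ L (t K L)) (pol ⌊ F ⌋ L)

      through : ∀ F p q → d K ⌊ F ⌋ ≡ p → d ⌊ F ⌋ L ≡ q → ℓ ^ (p ℕ.+ q) * (x ⌊ F ⌋ * u) ≈ κ ((p ℕ.+ q) !) * ((Pˡ F * Pᵘ F) * e)
      through B p q ≡.refl ≡.refl = κ-cancel (p ! ℕ.* q !) ⦃ p ℕ.!* q !≢0 ⦄ (begin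
        κ (p ! ℕ.* q !) * (ℓ ^ (p ℕ.+ q) * v)
          ≈⟨ *-congˡ (form-^ B r s (p ℕ.+ q)) ⟩
        κ (p ! ℕ.* q !) * ((a + b) ^ (p ℕ.+ q) * v)
          ≈⟨ ^-split p q (form-vanish (lower< B) rˡ _) (form-vanish (upper< B) rᵘ _) ⟩
        κ ((p ℕ.+ q) !) * (a ^ p * (b ^ q * v))
          ≈⟨ *-congˡ (volume k (fuel-lower B h) (lower< B) (ChowRelations-* (b ^ q) rˡ) lower-class _) ⟩
        κ ((p ℕ.+ q) !) * (κ (p !) * (Pˡ B * (κ (q !) * (Pᵘ B * e))))
          ≈⟨ solve 6 (λ m i j a b e → (m :* (i :* (a :* (j :* (b :* e))))) := ((i :* j) :* (m :* ((a :* b) :* e)))) refl _ _ _ (Pˡ B) (Pᵘ B) e ⟩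
        (κ (p !) * κ (q !)) * (κ ((p ℕ.+ q) !) * ((Pˡ B * Pᵘ B) * e))
          ≈⟨ *-congʳ (κ-* (p !) (q !)) ⟨
        κ (p ! ℕ.* q !) * (κ ((p ℕ.+ q) !) * ((Pˡ B * Pᵘ B) * e))
          ∎)
        where
        F = ⌊ B ⌋
        v = x F * u
        a = form K F (ev s ∘ π K F (t K L))
        b = form F L (ev s ∘ π F L (t K L))
        rˡ = ChowRelations-lower (lower< B) (upper< B) r
        rᵘ = ChowRelations-upper (lower< B) (upper< B) r
        upper-class : ∀ Fs → MaximalChain K Fs F → PointClass F L (prod Fs * v) e
        upper-class Fs cF Gs cG = begin
          prod Gs * (prod Fs * (x F * u))
            ≈⟨ solve 4 (λ g f x u → (g :* (f :* (x :* u))) := ((f :* (x :* g)) :* u)) refl (prod Gs) (prod Fs) (x F) u ⟩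
          (prod Fs * (x F * prod Gs)) * u
            ≈⟨ *-congʳ (prod-++ Fs (F ∷ Gs)) ⟨
          prod (Fs ++ F ∷ Gs) * u
            ≈⟨ c (Fs ++ F ∷ Gs) (chain-++ Fs cF cG) ⟩
          e ∎
        lower-class : PointClass K F (b ^ q * v) (κ (q !) * (Pᵘ B * e))
        lower-class Fs cF = begin
          prod Fs * (b ^ q * v)
            ≈⟨ solve 3 (λ f b v → (f :* (b :* v)) := (b :* (f :* v))) refl (prod Fs) (b ^ q) v ⟩
          b ^ q * (prod Fs * v)
            ≈⟨ volume k (fuel-upper B h) (upper< B) (ChowRelations-* (prod Fs) rᵘ) (upper-class Fs cF) _ ⟩
          κ (q !) * (Pᵘ B * e) ∎

      cases : ∀ m → d K L ≡ m → ℓ ^ d K L * u ≈ κ (d K L !) * (ev s (pol K L) * e)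
      cases zero eq = begin
        ℓ ^ d K L * u                          ≈⟨ *-congʳ (^-congʳ ℓ eq) ⟩
        -- `L` covers `K` here, so the empty flag is maximal and `u` itself is the class of a point.
        1# * u                                 ≈⟨ c [] (rk⇒⋖ {K = K} {L} K<L (≡.trans (rk-d {K = K} {L} K<L) (≡.cong (λ k → suc k ℕ.+ rkF K) eq)) ∷ [-]) ⟩
        e                                      ≈⟨ trans (*-identityˡ _) (*-identityˡ e) ⟨
        1# * (1# * e)                          ≈⟨ *-cong κ-1 (*-congʳ ι-1) ⟨
        κ 1 * (ev s (con 1ℝ) * e)         ≡⟨ ≡.cong₂ (λ k p → κ (k !) * (ev s p * e)) eq (≡.trans (pol-recursive K L) (PolStep-0 pol K L (polStep-view pol K L) eq)) ⟨
        κ (d K L !) * (ev s (pol K L) * e)     ∎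
      cases (suc m) eq = begin
        ℓ ^ d K L * u
          ≈⟨ *-congʳ (^-congʳ ℓ eq) ⟩
        ℓ ^ suc m * u
          ≈⟨ form-suc K L s m u ⟩
        Σ (between K L) (λ F → s F * (ℓ ^ m * (x ⌊ F ⌋ * u)))
          ≈⟨ Σ-cong (between K L) (λ F → *-congˡ (at F (ℕ.suc-injective (≡.trans (≡.sym eq) (d-split {F = ⌊ F ⌋} (lower< F) (upper< F)))))) ⟩
        Σ (between K L) (λ F → s F * (κ (m !) * ((Pˡ F * Pᵘ F) * e)))
          ≈⟨ Σ-cong (between K L) (λ F → solve 5 (λ s k a b e → (s :* (k :* ((a :* b) :* e))) := (((s :* a) :* b) :* (k :* e))) refl (s F) (κ (m !)) (Pˡ F) (Pᵘ F) e) ⟩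
        Σ (between K L) (λ F → ((s F * Pˡ F) * Pᵘ F) * (κ (m !) * e))
          ≈⟨ Σ-*ʳ (between K L) _ _ ⟨
        T * (κ (m !) * e)
          ≈⟨ *-identityˡ _ ⟨
        -- The inserted 1 is split as 1/d times d, where d is `suc m`: the factor d completes the
        -- factorial, and 1/d is the leading factor of `polSum`.
        1# * (T * (κ (m !) * e))
          ≈⟨ *-congʳ (÷-inverse m) ⟨
        (ι (1 ÷ suc m) * κ (suc m)) * (T * (κ (m !) * e))
          ≈⟨ solve 5 (λ i k t f e → ((i :* k) :* (t :* (f :* e))) := ((k :* f) :* ((i :* t) :* e))) refl _ _ T _ e ⟩
        (κ (suc m) * κ (m !)) * ((ι (1 ÷ suc m) * T) * e)
          ≈⟨ *-cong (κ-* (suc m) (m !)) (*-congʳ (*-congˡ (trans (ev-∑ s (between K L) _)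
               (Σ-cong (between K L) λ F → reflexive (≡.cong₂ (λ p q → (s F * p) * q)
                 (ev-substitute s (π K ⌊ F ⌋ (t K L)) (pol K ⌊ F ⌋)) (ev-substitute s (π ⌊ F ⌋ L (t K L)) (pol ⌊ F ⌋ L))))))) ⟨
        κ (suc m !) * (ev s (polSum pol K L m) * e)
          ≡⟨ ≡.cong₂ (λ k p → κ (k !) * (ev s p * e)) eq (≡.trans (pol-recursive K L) (PolStep-suc pol K L (polStep-view pol K L) eq)) ⟨
        κ (d K L !) * (ev s (pol K L) * e) ∎
        where
        T = Σ (between K L) (λ F → (s F * Pˡ F) * Pᵘ F)
        at : ∀ F → m ≡ d K ⌊ F ⌋ ℕ.+ d ⌊ F ⌋ L → ℓ ^ m * (x ⌊ F ⌋ * u) ≈ κ (m !) * ((Pˡ F * Pᵘ F) * e)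
        at F ≡.refl = through F _ _ ≡.refl ≡.refl

  form-volume : ∀ {K L : Flat M} → K < L → ∀ {u e} → ChowRelations K L u → PointClass K L u e →
                ∀ s → form K L s ^ d K L * u ≈ κ (d K L !) * (ev s (pol K L) * e)
  form-volume {K} {L} = volume (rkF L) (ℕ.m≤m+n (rkF L) (rkF K))

-- Polynomials acting on functionals by contraction.

-- ℝ[ V ⊎ V ] is ℝ[t][x], the left copy of V giving the variables x and the right copy
-- the variables t. A symmetric function w on lists is an ℝ[t]-linear functional on
-- ℝ[t][x] given by its values on monomials, and ρ p w is the functional q ↦ w(p q).
module Contraction (V : Set) where
  private
    module T = CommutativeRing ℝ[ V ]-commutativeRing
    module T+ = CommutativeSemigroupProperties T.+-commutativeSemigroup
    module T* = CommutativeSemigroupProperties T.*-commutativeSemigroup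
    module TR = RingProperties T.ring
    module TA = AbelianGroupProperties T.+-abelianGroup
  open T using (refl; sym; trans)
  open SetoidReasoning T.setoid

  Functional : Set
  Functional = List V → ℝ[ V ]

  infix 4 _≋_
  _≋_ : Functional → Functional → Set
  w ≋ w′ = ∀ Gs → w Gs ≈ₚ w′ Gs

  Symmetric : Functional → Set
  Symmetric w = ∀ {Gs Hs} → Gs ↭ Hs → w Gs ≈ₚ w Hs

  ρ : ℝ[ V ⊎ V ] → Functional → Functional
  ρ (con c)        w Gs = con c ⊗ w Gs
  ρ (var (inj₁ F)) w Gs = w (F ∷ Gs)
  ρ (var (inj₂ F)) w Gs = var F ⊗ w Gs
  ρ (p ⊕ q)        w Gs = ρ p w Gs ⊕ ρ q w Gs
  ρ (p ⊗ q)        w    = ρ p (ρ q w)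
  ρ (⊖ p)          w Gs = ⊖ ρ p w Gs

  ρ-cong : ∀ p {w w′} → w ≋ w′ → ρ p w ≋ ρ p w′
  ρ-cong (con c)        eq Gs = T.*-congˡ (eq Gs)
  ρ-cong (var (inj₁ F)) eq Gs = eq (F ∷ Gs)
  ρ-cong (var (inj₂ F)) eq Gs = T.*-congˡ (eq Gs)
  ρ-cong (p ⊕ q)        eq Gs = T.+-cong (ρ-cong p eq Gs) (ρ-cong q eq Gs)
  ρ-cong (p ⊗ q)        eq    = ρ-cong p (ρ-cong q eq)
  ρ-cong (⊖ p)          eq Gs = T.-‿cong (ρ-cong p eq Gs)

  ρ-symmetric : ∀ p {w} → Symmetric w → Symmetric (ρ p w)
  ρ-symmetric (con c)        s π = T.*-congˡ (s π)
  ρ-symmetric (var (inj₁ F)) s π = s (↭.prep F π)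
  ρ-symmetric (var (inj₂ F)) s π = T.*-congˡ (s π)
  ρ-symmetric (p ⊕ q)        s π = T.+-cong (ρ-symmetric p s π) (ρ-symmetric q s π)
  ρ-symmetric (p ⊗ q)        s   = ρ-symmetric p (ρ-symmetric q s)
  ρ-symmetric (⊖ p)          s π = T.-‿cong (ρ-symmetric p s π)

  ρ-+ : ∀ p w w′ → ρ p (λ Gs → w Gs ⊕ w′ Gs) ≋ (λ Gs → ρ p w Gs ⊕ ρ p w′ Gs)
  ρ-+ (con c)        w w′ Gs = T.distribˡ _ _ _
  ρ-+ (var (inj₁ F)) w w′ Gs = refl
  ρ-+ (var (inj₂ F)) w w′ Gs = T.distribˡ _ _ _
  ρ-+ (p ⊕ q)        w w′ Gs = trans (T.+-cong (ρ-+ p w w′ Gs) (ρ-+ q w w′ Gs)) (T+.interchange _ _ _ _)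
  ρ-+ (p ⊗ q)        w w′ Gs = trans (ρ-cong p (ρ-+ q w w′) Gs) (ρ-+ p (ρ q w) (ρ q w′) Gs)
  ρ-+ (⊖ p)          w w′ Gs = trans (T.-‿cong (ρ-+ p w w′ Gs)) (sym (TA.⁻¹-∙-comm _ _))

  ρ-* : ∀ p c w → ρ p (λ Gs → c ⊗ w Gs) ≋ (λ Gs → c ⊗ ρ p w Gs)
  ρ-* (con a)        c w Gs = T*.x∙yz≈y∙xz (con a) c (w Gs)
  ρ-* (var (inj₁ F)) c w Gs = refl
  ρ-* (var (inj₂ F)) c w Gs = T*.x∙yz≈y∙xz (var F) c (w Gs)
  ρ-* (p ⊕ q)        c w Gs = trans (T.+-cong (ρ-* p c w Gs) (ρ-* q c w Gs)) (sym (T.distribˡ c _ _))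
  ρ-* (p ⊗ q)        c w Gs = trans (ρ-cong p (ρ-* q c w) Gs) (ρ-* p c (ρ q w) Gs)
  ρ-* (⊖ p)          c w Gs = trans (T.-‿cong (ρ-* p c w Gs)) (TR.-‿distribʳ-* c _)

  ρ-0 : ∀ p {w} → w ≋ (λ _ → con 0ℝ) → ρ p w ≋ (λ _ → con 0ℝ)
  ρ-0 p {w} eq Gs = trans (ρ-cong p (λ Hs → trans (eq Hs) (sym (T.zeroˡ (con 0ℝ)))) Gs)
    (trans (ρ-* p (con 0ℝ) (λ _ → con 0ℝ) Gs) (T.zeroˡ _))

  ρ-neg : ∀ p w → ρ p (λ Gs → ⊖ w Gs) ≋ (λ Gs → ⊖ ρ p w Gs)
  ρ-neg p w Gs = begin
    ρ p (λ Gs → ⊖ w Gs) Gs              ≈⟨ ρ-cong p (λ Hs → TR.-1*x≈-x (w Hs)) Gs ⟨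
    ρ p (λ Gs → ⊖ con 1ℝ ⊗ w Gs) Gs     ≈⟨ ρ-* p (⊖ con 1ℝ) w Gs ⟩
    ⊖ con 1ℝ ⊗ ρ p w Gs                 ≈⟨ TR.-1*x≈-x _ ⟩
    ⊖ ρ p w Gs                          ∎

  -- For a variable x_G this is the invariance of `w` under exchanging the first two entries; it is
  -- the source of commutativity in `ρ-comm`.
  ρ-shift : ∀ p F {w} → Symmetric w → ρ p (λ Gs → w (F ∷ Gs)) ≋ (λ Gs → ρ p w (F ∷ Gs))
  ρ-shift (con c)        F s Gs = refl
  ρ-shift (var (inj₁ G)) F s Gs = s (↭.swap F G ↭.refl)
  ρ-shift (var (inj₂ G)) F s Gs = refl
  ρ-shift (p ⊕ q)        F s Gs = T.+-cong (ρ-shift p F s Gs) (ρ-shift q F s Gs)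
  ρ-shift (p ⊗ q)        F s Gs = trans (ρ-cong p (ρ-shift q F s) Gs) (ρ-shift p F (ρ-symmetric q s) Gs)
  ρ-shift (⊖ p)          F s Gs = T.-‿cong (ρ-shift p F s Gs)

  ρ-comm : ∀ p q {w} → Symmetric w → ρ p (ρ q w) ≋ ρ q (ρ p w)
  ρ-comm (con c)        q {w} s Gs = sym (ρ-* q (con c) w Gs)
  ρ-comm (var (inj₁ F)) q s Gs = sym (ρ-shift q F s Gs)
  ρ-comm (var (inj₂ F)) q {w} s Gs = sym (ρ-* q (var F) w Gs)
  ρ-comm (p ⊕ p′)       q {w} s Gs = trans (T.+-cong (ρ-comm p q s Gs) (ρ-comm p′ q s Gs)) (sym (ρ-+ q (ρ p w) (ρ p′ w) Gs))
  ρ-comm (p ⊗ p′)       q s Gs = trans (ρ-cong p (ρ-comm p′ q s) Gs) (ρ-comm p q (ρ-symmetric p′ s) Gs)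
  ρ-comm (⊖ p)          q {w} s Gs = trans (T.-‿cong (ρ-comm p q s Gs)) (sym (ρ-neg q (ρ p w) Gs))

  -- By recursion on the derivation of the congruence, so no normal form of polynomials enters.
  -- Associativity holds by definition because products act by composition; commutativity is the law
  -- that rests on the symmetry of `w`.
  ρ-resp : ∀ {p q w} → Symmetric w → p ≈ₚ q → ρ p w ≋ ρ q w
  ρ-resp s ≈-refl               Gs = refl
  ρ-resp s (≈-sym eq)           Gs = sym (ρ-resp s eq Gs)
  ρ-resp s (≈-trans eq eq′)     Gs = trans (ρ-resp s eq Gs) (ρ-resp s eq′ Gs)
  ρ-resp s (⊕-cong eq eq′)      Gs = T.+-cong (ρ-resp s eq Gs) (ρ-resp s eq′ Gs)
  ρ-resp s (⊗-cong {p} {p′} {q} {q′} eq eq′) Gs = trans (ρ-cong p (ρ-resp s eq′) Gs) (ρ-resp (ρ-symmetric q′ s) eq Gs)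
  ρ-resp s (⊖-cong eq)          Gs = T.-‿cong (ρ-resp s eq Gs)
  ρ-resp s (⊕-assoc p q r)      Gs = T.+-assoc _ _ _
  ρ-resp s (⊕-comm p q)         Gs = T.+-comm _ _
  ρ-resp s (⊕-identityˡ p)      Gs = trans (T.+-congʳ (T.zeroˡ _)) (T.+-identityˡ _)
  ρ-resp s (⊖-inverseˡ p)       Gs = trans (T.-‿inverseˡ _) (sym (T.zeroˡ _))
  ρ-resp s (⊗-assoc p q r)      Gs = refl
  ρ-resp s (⊗-comm p q)         Gs = ρ-comm p q s Gs
  ρ-resp s (⊗-identityˡ p)      Gs = T.*-identityˡ _
  ρ-resp {w = w} s (⊗-distribˡ p q r) Gs = ρ-+ p (ρ q w) (ρ r w) Gs
  ρ-resp s (con-cong eq)        Gs = T.*-congʳ (con-cong eq)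
  ρ-resp s (con-+ a b)          Gs = trans (T.*-congʳ (con-+ a b)) (T.distribʳ _ _ _)
  ρ-resp s (con-* a b)          Gs = trans (T.*-congʳ (con-* a b)) (T.*-assoc _ _ _)

  module _ {w : Functional} (w-sym : Symmetric w) where
    open Ideals ℝ[ V ⊎ V ]-commutativeRing

    -- Testing against all lists means that `w` vanishes on every multiple of p, not only on p; this
    -- is what makes the set an ideal.
    annihilator : Ideal
    annihilator = record
      { _∈I     = λ p → ρ p w ≋ (λ _ → con 0ℝ)
      ; resp-∈I = λ eq p∈ Gs → trans (sym (ρ-resp w-sym eq Gs)) (p∈ Gs)
      ; 0∈I     = λ Gs → T.zeroˡ _
      ; +-∈I    = λ p∈ q∈ Gs → trans (T.+-cong (p∈ Gs) (q∈ Gs)) (T.+-identityˡ _)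
      ; *-∈I    = λ r p∈ → ρ-0 r p∈
      }

    algebra : ℝ-Algebra
    algebra = record
      { commutativeRing = quotient annihilator
      ; ι      = con
      ; ι-cong = λ eq → lift (con-cong eq)
      ; ι-+    = λ a b → lift (con-+ a b)
      ; ι-*    = λ a b → lift (con-* a b)
      ; ι-0    = lift {con 0ℝ} {con 0ℝ} ≈-refl
      ; ι-1    = lift {con 1ℝ} {con 1ℝ} ≈-refl
      }
      where
      lift : ∀ {p q} → p ≈ₚ q → ρ (p ⊕ ⊖ q) w ≋ (λ _ → con 0ℝ)
      lift eq Gs = trans (T.+-congʳ (ρ-resp w-sym eq Gs)) (T.-‿inverseʳ _)

    private module Q = CommutativeRing (ℝ-Algebra.commutativeRing algebra)

    ≋⇒≈ : ∀ p q → ρ p w ≋ ρ q w → p Q.≈ q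
    ≋⇒≈ p q eq Gs = trans (T.+-congʳ (eq Gs)) (T.-‿inverseʳ _)

    ≈⇒≋ : ∀ p q → p Q.≈ q → ρ p w ≋ ρ q w
    ≈⇒≋ p q eq Gs = begin
      ρ p w Gs                                    ≈⟨ TA.//-rightDividesˡ (ρ q w Gs) (ρ p w Gs) ⟨
      (ρ p w Gs ⊕ ⊖ ρ q w Gs) ⊕ ρ q w Gs          ≈⟨ T.+-congʳ (eq Gs) ⟩
      con 0ℝ ⊕ ρ q w Gs                           ≈⟨ T.+-identityˡ _ ⟩
      ρ q w Gs                                    ∎

  polynomialAlgebra : ℝ-Algebra
  polynomialAlgebra = record
    { commutativeRing = ℝ[ V ]-commutativeRing
    ; ι = con ; ι-cong = con-cong ; ι-+ = con-+ ; ι-* = con-* ; ι-0 = ≈-refl ; ι-1 = ≈-refl }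

  open ListSum ℝ[ V ]-commutativeRing

  ρ-Σ : ∀ {B : Set} p (xs : List B) (w : B → Functional) → ρ p (λ Gs → Σ xs (λ b → w b Gs)) ≋ (λ Gs → Σ xs (λ b → ρ p (w b) Gs))
  ρ-Σ p []       w Gs = ρ-0 p (λ _ → refl) Gs
  ρ-Σ p (b ∷ xs) w Gs = trans (ρ-+ p (w b) (λ Gs → Σ xs (λ b → w b Gs)) Gs) (T.+-congˡ (ρ-Σ p xs w Gs))

  Σ-ρ : ∀ {B : Set} (xs : List B) (f : B → ℝ[ V ⊎ V ]) w → ρ (∑ (List.map f xs)) w ≋ (λ Gs → Σ xs (λ b → ρ (f b) w Gs))
  Σ-ρ []       f w Gs = T.zeroˡ _
  Σ-ρ (b ∷ xs) f w Gs = T.+-congˡ (Σ-ρ xs f w Gs)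

-- The degree functional of the Chow ring and the comparison of the two polynomials.

module Degree {n : ℕ} {M : Matroid n} {K L : Flat M} (K<L : K < L) (D : DegreeMap K L) where
  private
    V = Between K L
    module T = CommutativeRing ℝ[ V ]-commutativeRing
    module Chow = CommutativeRing (chowRing K L)
  open DegreeMap D
  open LeftModuleMorphisms.IsLeftModuleIsomorphism isIsomorphism using (⟦⟧-cong; +ᴹ-homo; 0ᴹ-homo)
  open T using (refl; sym; trans; reflexive)
  open ListSum ℝ[ V ]-commutativeRing
  open Contraction V
  open SetoidReasoning T.setoid

  -- The degree map, extended by zero to the pieces of degree k ≢ d K L.
  degᵗ : ∀ k → A K L k → ℝ[ V ]
  degᵗ k a with k ℕ.≟ d K L
  ... | yes ≡.refl = con (deg a)
  ... | no  _      = con 0ℝ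

  -- Two degrees with an equation between them, because the lengths of permuted lists agree only
  -- propositionally.
  degᵗ-cong : ∀ {j k} (a : A K L j) (b : A K L k) → j ≡ k → proj₁ a Chow.≈ proj₁ b → degᵗ j a ≈ₚ degᵗ k b
  degᵗ-cong {j} a b ≡.refl eq with j ℕ.≟ d K L
  ... | yes ≡.refl = con-cong (⟦⟧-cong eq)
  ... | no  _      = refl

  degᵗ-0 : ∀ k → degᵗ k (con 0ℝ , zero) ≈ₚ con 0ℝ
  degᵗ-0 k with k ℕ.≟ d K L
  ... | yes ≡.refl = con-cong 0ᴹ-homo
  ... | no  _      = refl

  degᵗ-+ : ∀ k (a b : A K L k) → degᵗ k (proj₁ a ⊕ proj₁ b , proj₂ a ⊕ proj₂ b) ≈ₚ degᵗ k a ⊕ degᵗ k b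
  degᵗ-+ k a b with k ℕ.≟ d K L
  ... | yes ≡.refl = trans (con-cong (+ᴹ-homo a b)) (con-+ (deg a) (deg b))
  ... | no  _      = sym (T.+-identityˡ _)

  degᵗ-d : ∀ a → degᵗ (d K L) a ≡ con (deg a)
  degᵗ-d a with d K L ℕ.≟ d K L
  ... | yes ≡.refl = ≡.refl
  ... | no  ≢      = contradiction ≡.refl ≢

  degᵗ-≢ : ∀ {k} a → k ≢ d K L → degᵗ k a ≡ con 0ℝ
  degᵗ-≢ {k} a k≢d with k ℕ.≟ d K L
  ... | yes k≡d = contradiction k≡d k≢d
  ... | no  _   = ≡.refl

  -- `flagMonomial` for lists: the functional `w` has to be defined on monomials of every degree.
  monomial : ∀ Fs → A K L (List.length Fs)
  monomial []       = con 1ℝ , con 1ℝ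
  monomial (F ∷ Fs) = var F ⊗ proj₁ (monomial Fs) , var F ⊗ proj₂ (monomial Fs)

  monomial-↭ : ∀ {Fs Gs} → Fs ↭ Gs → proj₁ (monomial Fs) ≈ₚ proj₁ (monomial Gs)
  monomial-↭ ↭.refl         = refl
  monomial-↭ (↭.prep F π)   = T.*-congˡ (monomial-↭ π)
  monomial-↭ (↭.swap F G π) = trans (T*.x∙yz≈y∙xz _ _ _) (T.*-congˡ (T.*-congˡ (monomial-↭ π)))
    where module T* = CommutativeSemigroupProperties T.*-commutativeSemigroup
  monomial-↭ (↭.trans π π′) = trans (monomial-↭ π) (monomial-↭ π′)

  monomial-vec : ∀ Fs {k} → List.length Fs ≡ k → ∃[ v ] (Vec.toList {n = k} v ≡ Fs × flagMonomial K L v .proj₁ ≡ proj₁ (monomial Fs))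
  monomial-vec []       ≡.refl = [] , ≡.refl , ≡.refl
  monomial-vec (F ∷ Fs) ≡.refl with v , eq , eq′ ← monomial-vec Fs ≡.refl = F ∷ v , ≡.cong (F ∷_) eq , ≡.cong (var F ⊗_) eq′

  vec-monomial : ∀ {k} (v : Vec V k) → proj₁ (monomial (Vec.toList v)) ≡ proj₁ (flagMonomial K L v)
  vec-monomial []      = ≡.refl
  vec-monomial (F ∷ v) = ≡.cong (var F ⊗_) (vec-monomial v)

  open Ideals ℝ[ V ]-commutativeRing using (gen; *-∈; resp; 0∈)

  ∈I⇒≈0 : ∀ p → Ideals.Generated ℝ[ V ]-commutativeRing (IncomparableProduct K L) p → p Chow.≈ con 0ℝ
  ∈I⇒≈0 p p∈ = p , con 0ℝ , p∈ , 0∈ , T.+-congˡ -0≈0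
    where
    -0≈0 : ⊖ con 0ℝ ≈ₚ con 0ℝ
    -0≈0 = trans (sym (T.+-identityʳ _)) (T.-‿inverseˡ _)

  chow-refl : ∀ {p q} → p ≈ₚ q → p Chow.≈ q
  chow-refl {p} {q} eq = con 0ℝ , con 0ℝ , 0∈ , 0∈ , trans (trans (T.+-congʳ eq) (T.-‿inverseʳ q)) (sym (T.+-identityˡ _))

  w : Functional
  w Gs = degᵗ (List.length Gs) (monomial Gs)

  w-sym : Symmetric w
  w-sym π = degᵗ-cong (monomial _) (monomial _) (↭.↭-length π) (chow-refl (monomial-↭ π))

  -- The quotient of ℝ[t][x] by the largest ideal on which the degree functional w vanishes.
  Q : ℝ-Algebra
  Q = algebra w-sym

  private
    module Qᵣ = CommutativeRing (ℝ-Algebra.commutativeRing Q)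
    module Q = ListSum (ℝ-Algebra.commutativeRing Q)
    module F = Fractions Q
    module FT = Fractions polynomialAlgebra

  x : Flat M → Qᵣ.Carrier
  x G = maybe′ (λ F → var (inj₁ F)) (con 0ℝ) (between? K L G)

  x-in : ∀ (F : V) → x ⌊ F ⌋ ≡ var (inj₁ F)
  x-in F = ≡.cong (maybe′ (λ F → var (inj₁ F)) (con 0ℝ)) (between?-≡ F)

  open Volume Q x using (form; form-volume; prod; PointClass)
  open Intervals Q x using (ChowRelations)

  ρ-x : ∀ F w′ → ρ (x ⌊ F ⌋) w′ ≋ (λ Gs → w′ (F ∷ Gs))
  ρ-x F w′ Gs = reflexive (≡.cong (λ p → ρ p w′ Gs) (x-in F))

  module _ {k : ℕ} (m : A K L k) where

    -- A linear form times a monomial as one element of a graded piece. In this shape the linear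
    -- relations of the Chow ring can be passed to the degree map.
    times : List V → A K L (suc k)
    times Bs = ∑ (List.map var Bs) ⊗ proj₁ m , hom Bs ⊗ proj₂ m
      where
      hom : ∀ Bs → Homogeneous 1 (∑ (List.map var Bs))
      hom []       = zero
      hom (B ∷ Bs) = var B ⊕ hom Bs

    degᵗ-times : ∀ Bs → degᵗ (suc k) (times Bs) ≈ₚ Σ Bs (λ B → degᵗ (suc k) (var B ⊗ proj₁ m , var B ⊗ proj₂ m))
    degᵗ-times []       = trans (degᵗ-cong (times []) (con 0ℝ , zero) ≡.refl (chow-refl (T.zeroˡ _))) (degᵗ-0 (suc k))
    degᵗ-times (B ∷ Bs) = trans (degᵗ-cong (times (B ∷ Bs)) (proj₁ Bm ⊕ proj₁ (times Bs) , proj₂ Bm ⊕ proj₂ (times Bs)) ≡.refl (chow-refl (T.distribʳ _ _ _)))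
      (trans (degᵗ-+ (suc k) Bm (times Bs)) (T.+-congˡ (degᵗ-times Bs)))
      where
      Bm : A K L (suc k)
      Bm = var B ⊗ proj₁ m , var B ⊗ proj₂ m

  Σ-filter : ∀ i (Bs : List V) (f : V → ℝ[ V ]) →
             Σ (List.filter (λ B → i ∈? elements ⌊ B ⌋) Bs) f ≈ₚ Σ Bs (λ B → FT.χ (elements ⌊ B ⌋) i (f B))
  Σ-filter i []       f = refl
  Σ-filter i (B ∷ Bs) f with i ∈? elements ⌊ B ⌋
  ... | yes i∈B = T.+-cong (reflexive (≡.sym (FT.χ-∈ (f B) i∈B))) (Σ-filter i Bs f)
  ... | no  i∉B = trans (Σ-filter i Bs f) (sym (trans (T.+-congʳ (reflexive (FT.χ-∉ (f B) i∉B))) (T.+-identityˡ _)))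

  ρ-χ : ∀ (S : Subset n) i p w′ Gs → ρ (F.χ S i p) w′ Gs ≈ₚ FT.χ S i (ρ p w′ Gs)
  ρ-χ S i p w′ Gs with lookup S i
  ... | true  = refl
  ... | false = T.zeroˡ _

  -- Connects the two encodings of the flats containing `i`: indicators in `ChowRelations`, a
  -- filtered list in the Chow ring.
  Σ-χ-deg : ∀ i Gs → ρ (Q.Σ (between K L) (λ G → F.χ (elements ⌊ G ⌋) i (x ⌊ G ⌋ Qᵣ.* Qᵣ.1#))) w Gs ≈ₚ
            degᵗ (suc (List.length Gs)) (times (monomial Gs) (List.filter (λ B → i ∈? elements ⌊ B ⌋) (between K L)))
  Σ-χ-deg i Gs = begin
    ρ (Q.Σ (between K L) (λ G → F.χ (elements ⌊ G ⌋) i (x ⌊ G ⌋ ⊗ con 1ℝ))) w Gs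
      ≈⟨ Σ-ρ (between K L) _ w Gs ⟩
    Σ (between K L) (λ G → ρ (F.χ (elements ⌊ G ⌋) i (x ⌊ G ⌋ ⊗ con 1ℝ)) w Gs)
      ≈⟨ Σ-cong (between K L) (λ G → trans (ρ-χ (elements ⌊ G ⌋) i (x ⌊ G ⌋ ⊗ con 1ℝ) w Gs)
           (FT.χ-cong (elements ⌊ G ⌋) i (trans (ρ-x G (λ Hs → con 1ℝ ⊗ w Hs) Gs) (T.*-identityˡ _)))) ⟩
    Σ (between K L) (λ G → FT.χ (elements ⌊ G ⌋) i (w (G ∷ Gs)))
      ≈⟨ Σ-filter i (between K L) _ ⟨
    Σ (List.filter (λ B → i ∈? elements ⌊ B ⌋) (between K L)) (λ G → w (G ∷ Gs))
      ≈⟨ degᵗ-times (monomial Gs) (List.filter (λ B → i ∈? elements ⌊ B ⌋) (between K L)) ⟨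
    degᵗ (suc (List.length Gs)) (times (monomial Gs) (List.filter (λ B → i ∈? elements ⌊ B ⌋) (between K L)))
      ∎

  -- Tested against a monomial `Gs`, each relation becomes an equation between classes in one graded
  -- piece of the Chow ring, where it is a multiple of a generator of the ideal, and the degree map
  -- respects such equations.
  rel : ChowRelations K L Qᵣ.1#
  rel .ChowRelations.incomp {F} {G} K<F F<L K<G G<L F⊈G G⊈F = ≋⇒≈ w-sym (x F ⊗ (x G ⊗ con 1ℝ)) (con 0ℝ) λ Gs → begin
    ρ (x F) (ρ (x G) (λ Hs → con 1ℝ ⊗ w Hs)) Gs  ≈⟨ ρ-x B _ Gs ⟩
    ρ (x G) (λ Hs → con 1ℝ ⊗ w Hs) (B ∷ Gs)      ≈⟨ ρ-x C _ (B ∷ Gs) ⟩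
    con 1ℝ ⊗ w (C ∷ B ∷ Gs)                      ≈⟨ T.*-identityˡ _ ⟩
    w (C ∷ B ∷ Gs)                               ≈⟨ degᵗ-cong (monomial (C ∷ B ∷ Gs)) (con 0ℝ , zero) ≡.refl (∈I⇒≈0 _
                                                      (resp (trans (T.*-comm _ _) (T.*-assoc _ _ _)) (*-∈ (proj₁ (monomial Gs)) (gen (incomparable C B G⊈F F⊈G))))) ⟩
    degᵗ (suc (suc (List.length Gs))) (con 0ℝ , zero) ≈⟨ degᵗ-0 _ ⟩
    con 0ℝ                                       ≈⟨ T.zeroˡ _ ⟨
    con 0ℝ ⊗ w Gs                                ∎
    where
    B C : V
    B = mkBetween F K<F F<L
    C = mkBetween G K<G G<L
  rel .ChowRelations.balanced {i} {j} i∈ j∈ = ≋⇒≈ w-sym (side i) (side j) λ Gs →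
    trans (Σ-χ-deg i Gs) (trans (degᵗ-cong (times (monomial Gs) _) (times (monomial Gs) _) ≡.refl (equal Gs)) (sym (Σ-χ-deg j Gs)))
    where
    side : Fin n → ℝ[ _ ]
    side i = Q.Σ (between K L) (λ G → F.χ (elements ⌊ G ⌋) i (x ⌊ G ⌋ ⊗ con 1ℝ))
    equal : ∀ Gs → (∑∋ K L i ⊗ proj₁ (monomial Gs)) Chow.≈ (∑∋ K L j ⊗ proj₁ (monomial Gs))
    equal Gs with i Fin.≟ j
    ... | yes ≡.refl = chow-refl refl
    ... | no  i≢j    = con 0ℝ , m ⊗ (∑∋ K L i ⊕ ⊖ ∑∋ K L j) , 0∈ , *-∈ m (gen (linear i∈ j∈ i≢j)) , (begin
        ∑∋ K L i ⊗ m ⊕ ⊖ (∑∋ K L j ⊗ m)       ≈⟨ T.+-congˡ (-‿distribˡ-* _ m) ⟩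
        ∑∋ K L i ⊗ m ⊕ (⊖ ∑∋ K L j) ⊗ m       ≈⟨ T.distribʳ m _ _ ⟨
        (∑∋ K L i ⊕ ⊖ ∑∋ K L j) ⊗ m           ≈⟨ T.*-comm _ m ⟩
        m ⊗ (∑∋ K L i ⊕ ⊖ ∑∋ K L j)           ≈⟨ T.+-identityˡ _ ⟨
        con 0ℝ ⊕ m ⊗ (∑∋ K L i ⊕ ⊖ ∑∋ K L j)  ∎)
      where
      open RingProperties T.ring using (-‿distribˡ-*)
      m = proj₁ (monomial Gs)

  ρ-prod : ∀ Bs {w′} → Symmetric w′ → ∀ Gs → ρ (prod (List.map ⌊_⌋ Bs)) w′ Gs ≈ₚ w′ (Bs ++ Gs)
  ρ-prod []       s Gs = T.*-identityˡ _
  ρ-prod (B ∷ Bs) {w′} s Gs = begin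
    ρ (x ⌊ B ⌋) (ρ (prod (List.map ⌊_⌋ Bs)) w′) Gs   ≈⟨ ρ-x B _ Gs ⟩
    ρ (prod (List.map ⌊_⌋ Bs)) w′ (B ∷ Gs)           ≈⟨ ρ-prod Bs s (B ∷ Gs) ⟩
    w′ (Bs ++ B ∷ Gs)                                ≈⟨ s (↭.shift B Bs Gs) ⟩
    w′ (B ∷ Bs ++ Gs)                                ∎

  point : Functional
  point []      = con 1ℝ
  point (_ ∷ _) = con 0ℝ

  -- A maximal flag has length `d K L`. At the empty list its value is given by `deg-flag`; any
  -- further variable exceeds the top degree, where `degᵗ` is zero.
  prod-point : ∀ Fs → MaximalChain K Fs L → ∀ Gs → ρ (prod Fs) w Gs ≈ₚ point Gs
  prod-point Fs c Gs with Bs , ≡.refl ← chain-between {K = K} {L} Fs c = trans (ρ-prod Bs w-sym Gs) (value Gs)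
    where
    size : List.length Bs ≡ d K L
    size = ≡.trans (≡.sym (List.length-map ⌊_⌋ Bs)) (chain-length Fs c)
    value : ∀ Gs → w (Bs ++ Gs) ≈ₚ point Gs
    value [] with v , v≡ , m≡ ← monomial-vec Bs size = begin
      w (Bs ++ [])                           ≈⟨ w-sym (↭.↭-reflexive (List.++-identityʳ Bs)) ⟩
      w Bs                                   ≈⟨ degᵗ-cong (monomial Bs) (flagMonomial K L v) size (chow-refl (reflexive (≡.sym m≡))) ⟩
      degᵗ (d K L) (flagMonomial K L v)      ≡⟨ degᵗ-d (flagMonomial K L v) ⟩
      con (deg (flagMonomial K L v))         ≈⟨ con-cong (deg-flag v (≡.subst (λ Bs → MaximalChain K (List.map ⌊_⌋ Bs) L) (≡.sym v≡) c)) ⟩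
      con 1ℝ                                 ∎
    value (G ∷ Gs) = reflexive (degᵗ-≢ (monomial (Bs ++ G ∷ Gs)) λ eq → ℕ.m+1+n≢m (d K L)
      (≡.trans (≡.cong (ℕ._+ suc (List.length Gs)) (≡.sym size)) (≡.trans (≡.sym (List.length-++ Bs)) eq)))

  chain : List (Flat M)
  chain = proj₁ (chain-exists {K = K} {L} K<L)

  e : Qᵣ.Carrier
  e = prod chain

  -- Equality in `Q` means equal action on `w`, and every maximal flag acts as `point`.
  point-class : PointClass K L Qᵣ.1# e
  point-class Fs c = ≋⇒≈ w-sym (prod Fs ⊗ con 1ℝ) e λ Gs → begin
    ρ (prod Fs) (λ Hs → con 1ℝ ⊗ w Hs) Gs  ≈⟨ ρ-cong (prod Fs) (λ Hs → T.*-identityˡ (w Hs)) Gs ⟩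
    ρ (prod Fs) w Gs                       ≈⟨ prod-point Fs c Gs ⟩
    point Gs                               ≈⟨ prod-point chain (proj₂ (chain-exists {K = K} {L} K<L)) Gs ⟨
    ρ e w Gs                               ∎

  s : V → Qᵣ.Carrier
  s F = var (inj₂ F)

  open AlgebraProperties Q using (ev; _^_)

  ρ-ev : ∀ p w′ Gs → ρ (ev s p) w′ Gs ≈ₚ p ⊗ w′ Gs
  ρ-ev (con a) w′ Gs = refl
  ρ-ev (var F) w′ Gs = refl
  ρ-ev (p ⊕ q) w′ Gs = trans (T.+-cong (ρ-ev p w′ Gs) (ρ-ev q w′ Gs)) (sym (T.distribʳ _ _ _))
  ρ-ev (p ⊗ q) w′ Gs = trans (ρ-ev p _ Gs) (trans (T.*-congˡ (ρ-ev q w′ Gs)) (sym (T.*-assoc _ _ _)))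
  ρ-ev (⊖ p)   w′ Gs = trans (T.-‿cong (ρ-ev p w′ Gs)) (-‿distribˡ-* p _)
    where open RingProperties T.ring using (-‿distribˡ-*)

  -- The contraction of a degree functional by x_F, matching the action of `var (inj₁ F)` under `ρ`.
  multiply : ∀ {k} → (A K L (suc k) → ℝ) → V → A K L k → ℝ
  multiply f F (a , ha) = f (var F ⊗ a , var F ⊗ ha)

  extend-· : ∀ {k} f (Bs : List V) (u : A[t] K L k) →
             extend K L f (_·_ K L (List.map (λ F → (var F , var F) , var F) Bs) u) ≈ₚ
             Σ Bs (λ B → var B ⊗ extend K L (multiply f B) u)
  extend-· f []       u = refl
  extend-· {k} f (B ∷ Bs) u = begin
    extend K L f (row ++ rest)                                            ≡⟨ ≡.cong ∑ (List.map-++ _ row rest) ⟩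
    ∑ (List.map _ row ++ List.map _ rest)                                 ≈⟨ Σ-id (List.map _ row) (List.map _ rest) ⟩
    extend K L f row ⊕ extend K L f rest                                  ≈⟨ T.+-cong (row-≈ u) (extend-· f Bs u) ⟩
    var B ⊗ extend K L (multiply f B) u ⊕ Σ Bs (λ B → var B ⊗ extend K L (multiply f B) u) ∎
    where
    rest : A[t] K L (suc k)
    rest = _·_ K L (List.map (λ F → (var F , var F) , var F) Bs) u
    entry : A K L k × ℝ[ V ] → A K L (suc k) × ℝ[ V ]
    entry ((a , ha) , p) = (var B ⊗ a , var B ⊗ ha) , var B ⊗ p
    row : A[t] K L (suc k)
    row = List.map entry u
    Σ-id : ∀ ps qs → ∑ (ps ++ qs) ≈ₚ ∑ ps ⊕ ∑ qs
    Σ-id []       qs = sym (T.+-identityˡ _)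
    Σ-id (p ∷ ps) qs = trans (T.+-congˡ (Σ-id ps qs)) (sym (T.+-assoc _ _ _))
    row-≈ : ∀ u → extend K L f (List.map entry u) ≈ₚ var B ⊗ extend K L (multiply f B) u
    row-≈ []                    = sym (T.zeroʳ _)
    row-≈ (((a , ha) , p) ∷ u) = trans (T.+-cong (T*.x∙yz≈y∙xz _ _ _) (row-≈ u)) (sym (T.distribˡ _ _ _))
      where module T* = CommutativeSemigroupProperties T.*-commutativeSemigroup

  ρ-form : ∀ w′ Gs → ρ (form K L s) w′ Gs ≈ₚ Σ (between K L) (λ F → var F ⊗ w′ (F ∷ Gs))
  ρ-form w′ Gs = trans (Σ-ρ (between K L) (λ F → s F ⊗ x ⌊ F ⌋) w′ Gs) (Σ-cong (between K L) λ F → T.*-congˡ (ρ-x F w′ Gs))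

  -- Stated for any functional that agrees with `f` on the monomials of degree k, since the
  -- induction replaces both by their contractions with x_F.
  form-extend : ∀ k f {w′} → Symmetric w′ → (∀ (Fs : Vec V k) → w′ (Vec.toList Fs) ≈ₚ con (f (flagMonomial K L Fs))) →
                ρ (form K L s ^ k) w′ [] ≈ₚ extend K L f (∑xt^_ K L k)
  form-extend zero    f {w′} sw h = begin
    con 1ℝ ⊗ w′ []                                 ≈⟨ T.*-comm _ _ ⟩
    w′ [] ⊗ con 1ℝ                                 ≈⟨ T.*-congʳ (h []) ⟩
    con (f (con 1ℝ , con 1ℝ)) ⊗ con 1ℝ             ≈⟨ T.+-identityʳ _ ⟨
    con (f (con 1ℝ , con 1ℝ)) ⊗ con 1ℝ ⊕ con 0ℝ    ∎
  form-extend (suc k) f {w′} sw h = begin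
    ρ ℓ (ρ (ℓ ^ k) w′) []
      -- In a composition the right factor acts first; the induction needs the split-off ℓ to act
      -- first, so as to produce the contracted functionals.
      ≈⟨ ρ-comm ℓ (ℓ ^ k) sw [] ⟩
    ρ (ℓ ^ k) (ρ ℓ w′) []
      ≈⟨ ρ-cong (ℓ ^ k) (ρ-form w′) [] ⟩
    ρ (ℓ ^ k) (λ Gs → Σ (between K L) (λ F → var F ⊗ w′ (F ∷ Gs))) []
      ≈⟨ ρ-Σ (ℓ ^ k) (between K L) (λ F Gs → var F ⊗ w′ (F ∷ Gs)) [] ⟩
    Σ (between K L) (λ F → ρ (ℓ ^ k) (λ Gs → var F ⊗ w′ (F ∷ Gs)) [])
      ≈⟨ Σ-cong (between K L) (λ F → trans (ρ-* (ℓ ^ k) (var F) (λ Gs → w′ (F ∷ Gs)) [])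
           (T.*-congˡ (form-extend k (multiply f F) (sw ∘ ↭.prep F) (λ Fs → h (F ∷ Fs))))) ⟩
    Σ (between K L) (λ F → var F ⊗ extend K L (multiply f F) (∑xt^_ K L k))
      ≈⟨ extend-· f (between K L) (∑xt^_ K L k) ⟨
    extend K L f (∑xt^_ K L (suc k))
      ∎
    where ℓ = form K L s

  vol≈pol : vol K L D ≈ₚ pol K L
  vol≈pol = begin
    con (1 ÷ N) ⊗ extend K L deg (∑xt^_ K L (d K L))
      ≈⟨ T.*-congˡ (form-extend (d K L) deg w-sym λ Fs → trans (degᵗ-cong (monomial (Vec.toList Fs)) (flagMonomial K L Fs)
           (Vec.length-toList Fs) (chow-refl (reflexive (vec-monomial Fs)))) (reflexive (degᵗ-d _))) ⟨
    con (1 ÷ N) ⊗ ρ (ℓ ^ d K L) w []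
      ≈⟨ T.*-congˡ (ρ-cong (ℓ ^ d K L) (λ Hs → T.*-identityˡ (w Hs)) []) ⟨
    con (1 ÷ N) ⊗ ρ (ℓ ^ d K L ⊗ con 1ℝ) w []
      -- The identity in `Q` is read off at the empty list, that is, paired with the monomial 1.
      ≈⟨ T.*-congˡ (≈⇒≋ w-sym (ℓ ^ d K L ⊗ con 1ℝ) (F.κ N ⊗ (ev s (pol K L) ⊗ e)) (form-volume {K} {L} K<L {e = e} rel point-class s) []) ⟩
    con (1 ÷ N) ⊗ ρ (F.κ N) (ρ (ev s (pol K L)) (ρ e w)) []
      ≈⟨ T.*-congˡ (reflexive (≡.trans (≡.cong (λ p → ρ p (ρ (ev s (pol K L)) (ρ e w)) []) (F.κ-def N)) (≡.cong (_⊗ ρ (ev s (pol K L)) (ρ e w) []) (≡.sym (FT.κ-def N))))) ⟩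
    con (1 ÷ N) ⊗ (FT.κ N ⊗ ρ (ev s (pol K L)) (ρ e w) [])
      ≈⟨ T.*-assoc _ _ _ ⟨
    (con (1 ÷ N) ⊗ FT.κ N) ⊗ ρ (ev s (pol K L)) (ρ e w) []
      ≈⟨ T.*-cong (inverse N ⦃ d K L ℕ.!≢0 ⦄) (ρ-ev (pol K L) (ρ e w) []) ⟩
    con 1ℝ ⊗ (pol K L ⊗ ρ e w [])
      ≈⟨ T.*-identityˡ _ ⟩
    pol K L ⊗ ρ e w []
      ≈⟨ T.*-congˡ (prod-point chain (proj₂ (chain-exists {K = K} {L} K<L)) []) ⟩
    pol K L ⊗ con 1ℝ
      ≈⟨ T.*-identityʳ _ ⟩
    pol K L
      ∎
    where
    N = d K L !
    ℓ = form K L s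
    inverse : ∀ k .⦃ _ : ℕ.NonZero k ⦄ → con (1 ÷ k) ⊗ FT.κ k ≈ₚ con 1ℝ
    inverse (suc m) = FT.÷-inverse m

theorem5p3 : ∀ {n : ℕ} (M : Matroid n) (K L : Flat M) → K < L →
    (D : DegreeMap K L) → vol K L D ≈ₚ pol K L
theorem5p3 M K L K<L D = Degree.vol≈pol K<L D
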